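{- Let $\Gamma$ be a finite connected bipartite graph with ordered bipartition $(B|B')$, let $G\leq\mathrm{Aut}(\Gamma)$, let $1\neq N\lhd G$, and let $r\geq3$ be an integer. Suppose that: (i) $\Gamma$ is $r$-starlike relative to $N$, and $\Gamma$ is locally $(G,4)$-distance transitive; (ii) the adjacency design $\mathcal{D}(\Gamma)$ is $G$-pairwise transitive and $N$-nicely affine with $r$ parallel classes of blocks. If $N$ is regular on $B$, then $N$ is elementary abelian and $\Gamma$, $\mathcal{D}(\Gamma)$ can be obtained (up to isomorphism) from the vector space construction described in the context.
   Context: All graphs are finite, simple and without loops. The vector space construction. Let $V=V(d,p)$ be a vector space of dimension $d$ over the field with $p$ elements, $p$ prime, with group of translations $\hat N$, and let $\hat G=\hat N.\hat G_0\leq\mathrm{AGL}(d,p)$ with $\hat G_0\leq\mathrm{GL}(d,p)$, such that: (a) $\hat G^V$ has rank $2$ or $3$; (b) there exists a $\hat G_0$-orbit $\mathcal{M}=\{M_1,\ldots,M_r\}$ ($r\geq3$) of subspaces of $V$ such that $\hat G_0^{\mathcal{M}}$ is $2$-transitive (not necessarily faithful); (c) $V=M_1+M_2$; (d) the stabiliser $(\hat G_0)_{M_1}$ acts transitively on $(V/M_1)^*=\{v+M_1\mid v\in V\setminus M_1\}$; (e) $\bigcup_{i=1}^r M_i^*$ is a $\hat G_0$-orbit, where $M_i^*=M_i\setminus\{0\}$. The construction produces the design $(V,\bigcup_{i=1}^r V/M_i,\mathcal{I})$ with point set $V$, blocks all cosets of the $M_i$, and incidence given by inclusion, and its incidence graph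 (the bipartite graph with ordered bipartition (points | blocks) and adjacency given by incidence). $\hat G^X$ denotes the permutation group induced on $X$. The rank of a transitive permutation group is the number of orbits of a point stabiliser. A group is regular on a set if it is transitive and only the identity fixes an element of the set. Locally $(G,s)$-distance transitive: the graph has diameter at least $s$, $G$ is a subgroup of its automorphism group, and for each vertex $v$ and each $1\leq i\leq s$ the stabiliser $G_v$ is transitive on the set of vertices at distance $i$ from $v$. $r$-starlike: a connected bipartite graph with ordered bipartition $(B|B')$ is $r$-starlike relative to $N$ if $N\leq\mathrm{Aut}(\Gamma)$, $r\geq2$, $N$ is transitive on $B$, and $N$ has exactly $r$ orbits on $B'$. A design $(\mathcal{P},\mathcal{B},\mathcal{I})$ consists of a point set, a block set and an incidence relation $\mathcal{I}\subseteq\mathcal{P}\times\mathcal{B}$; automorphisms are permutations of $\mathcal{P}\cup\mathcal{B}$ preserving points, blocks and incidence. Two distinct points are collinear if incident with at least one common block, otherwise non-collinear; two distinct blocks are intersecting if incident with at least one common point, otherwise non-intersecting. The adjacency design $\mathcal{D}(\Gamma)$ has point set $B$, block set $B'$ and incidence given by adjacency in $\Gamma$. $G$-pairwise transitive: $G$ is a group of automorphisms transitive on each of the following six (possibly empty) sets: incident and non-incident point-block pairs, collinear and non-collinear point pairs, intersecting and non-intersecting block pairs (ordered pairs of distinct elements). $N$-nicely affine: $N$ is a group of automorphisms transitive on points, and there is a constant $\mu$ such that distinct blocks are incident with exactly $\mu$ common points if they are in different $N$-orbits and with no common point if they are in the same $N$-orbit. The $N$-orbits on blocks are the parallel classes.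 -}

module Defs where

open import Algebra.Bundles using (Group)
import Algebra.Definitions.RawMonoid as RawMonoidDefinitions
open import Data.Empty using (⊥)
open import Data.Fin.Base using (Fin; toℕ; inject≤)
open import Data.Fin.Patterns using (0F; 1F)
open import Data.Nat.Base as ℕ using (ℕ; zero; suc; NonZero)
open import Data.Nat.DivMod using (_mod_)
open import Data.Nat.Primality using (Prime; prime⇒nonZero)
open import Data.Product.Base using (Σ-syntax; ∃-syntax; _×_; _,_; proj₁; proj₂)
open import Data.Sum.Base using (_⊎_; inj₁; inj₂; [_,_]′)
open import Data.Sum.Relation.Binary.Pointwise using (_⊎ₛ_; inj₁; inj₂)
open import Data.Vec.Base using (Vec; zipWith; map; replicate)
open import Function.Bundles using (Inverse; Bijection; _⇔_)
import Function.Construct.Composition as Composition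
import Function.Construct.Identity as Identity
import Function.Construct.Symmetry as Symmetry
open import Level using (0ℓ)
open import Relation.Binary.Bundles using (Setoid)
open import Relation.Binary.Core using (Rel; REL)
open import Relation.Binary.Definitions using (Symmetric; Irreflexive; _Respects₂_; Decidable)
open import Relation.Binary.PropositionalEquality using (_≡_; _≢_)
import Relation.Binary.PropositionalEquality as ≡
open import Relation.Nullary.Negation using (¬_)
open import Relation.Unary using (Pred; _∈_; _∉_; _⊆_; _≐_; U; ∅)
open import Relation.Unary.Properties using (≐-refl; ≐-sym; ≐-trans)

FinSetoid : ℕ → Setoid 0ℓ 0ℓ
FinSetoid n = ≡.setoid (Fin n)

-- S as a setoid in its own right: membership proofs are not compared.
SubSetoid : (X : Setoid 0ℓ 0ℓ) → Pred (Setoid.Carrier X) 0ℓ → Setoid 0ℓ 0ℓ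
SubSetoid X S = record
  { Carrier       = Σ[ x ∈ Carrier ] x ∈ S
  ; _≈_           = λ x y → proj₁ x ≈ proj₁ y
  ; isEquivalence = record { refl = refl ; sym = sym ; trans = trans }
  }
  where open Setoid X

HasSize : (X : Setoid 0ℓ 0ℓ) → Pred (Setoid.Carrier X) 0ℓ → ℕ → Set
HasSize X S n = Bijection (SubSetoid X S) (FinSetoid n)

IsFinite : Setoid 0ℓ 0ℓ → Set
IsFinite X = ∃[ n ] Inverse X (FinSetoid n)

OnLeft OnRight : {A B : Set} → Pred (A ⊎ B) 0ℓ
OnLeft  = [ U , ∅ ]′
OnRight = [ ∅ , U ]′

record Subgroup (𝔾 : Group 0ℓ 0ℓ) : Set₁ where
  open Group 𝔾
  field
    Member    : Pred Carrier 0ℓ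
    resp      : ∀ {g h} → g ≈ h → Member g → Member h
    ε-closed  : Member ε
    ∙-closed  : ∀ {g h} → Member g → Member h → Member (g ∙ h)
    ⁻¹-closed : ∀ {g} → Member g → Member (g ⁻¹)

open Subgroup public using (Member)

module _ {𝔾 : Group 0ℓ 0ℓ} where
  open Group 𝔾
  open RawMonoidDefinitions rawMonoid using () renaming (_×_ to _times_)

  IsTrivial : Subgroup 𝔾 → Set
  IsTrivial N = ∀ g → g ∈ Member N → g ≈ ε

  _⊲_ : Rel (Subgroup 𝔾) 0ℓ
  N ⊲ G = Member N ⊆ Member G
        × (∀ g n → g ∈ Member G → n ∈ Member N → (g ∙ n) ∙ g ⁻¹ ∈ Member N)

  IsElementaryAbelian : Subgroup 𝔾 → Set
  IsElementaryAbelian N =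
      (∀ g h → g ∈ Member N → h ∈ Member N → g ∙ h ≈ h ∙ g)
    × ∃[ p ] (Prime p × (∀ g → g ∈ Member N → p times g ≈ ε))

infixr 9 _⟨$⟩_

_⟨$⟩_ : {X Y : Setoid 0ℓ 0ℓ} → Inverse X Y → Setoid.Carrier X → Setoid.Carrier Y
_⟨$⟩_ = Inverse.to

Perm : Setoid 0ℓ 0ℓ → Set
Perm X = Inverse X X

Sym : Setoid 0ℓ 0ℓ → Group 0ℓ 0ℓ
Sym X = record
  { Carrier = Perm X
  ; _≈_     = λ g h → ∀ x → g ⟨$⟩ x ≈ h ⟨$⟩ x
  ; _∙_     = λ g h → Composition.inverse h g
  ; ε       = Identity.inverse X
  ; _⁻¹     = Symmetry.inverse
  ; isGroup = record
    { isMonoid = record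
      { isSemigroup = record
        { isMagma = record
          { isEquivalence = record
            { refl  = λ _ → refl
            ; sym   = λ p x → sym (p x)
            ; trans = λ p q x → trans (p x) (q x)
            }
          ; ∙-cong = λ {g} {h} {k} {l} p q x →
              trans (Inverse.to-cong g (q x)) (p (l ⟨$⟩ x))
          }
        ; assoc = λ _ _ _ _ → refl
        }
      ; identity = (λ _ _ → refl) , (λ _ _ → refl)
      }
    ; inverse = Inverse.strictlyInverseʳ , Inverse.strictlyInverseˡ
    ; ⁻¹-cong = λ {g} {h} p x →
        trans (Inverse.from-cong g
                (trans (sym (Inverse.strictlyInverseˡ h x))
                       (sym (p (Inverse.from h x)))))
              (Inverse.strictlyInverseʳ g (Inverse.from h x))
    }
  }
  where open Setoid X

PermGroup : Setoid 0ℓ 0ℓ → Set₁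
PermGroup X = Subgroup (Sym X)

module _ {X : Setoid 0ℓ 0ℓ} where
  open Setoid X

  SameOrbit : PermGroup X → Rel Carrier 0ℓ
  SameOrbit H x y = ∃[ h ] (h ∈ Member H × h ⟨$⟩ x ≈ y)

  OrbitSetoid : PermGroup X → Pred Carrier 0ℓ → Setoid 0ℓ 0ℓ
  OrbitSetoid H S = record
    { Carrier       = Σ[ x ∈ Carrier ] x ∈ S
    ; _≈_           = λ x y → SameOrbit H (proj₁ x) (proj₁ y)
    ; isEquivalence = record
      { refl  = Group.ε (Sym X) , Subgroup.ε-closed H , refl
      ; sym   = λ { (h , h∈H , hx≈y) → Group._⁻¹ (Sym X) h
                  , Subgroup.⁻¹-closed H h∈H
                  , trans (Inverse.from-cong h (sym hx≈y)) (Inverse.strictlyInverseʳ h _) }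
      ; trans = λ { (h , h∈H , hx≈y) (k , k∈H , ky≈z) → Group._∙_ (Sym X) k h
                  , Subgroup.∙-closed H k∈H h∈H
                  , trans (Inverse.to-cong k hx≈y) ky≈z }
      }
    }

  NumberOfOrbits : PermGroup X → Pred Carrier 0ℓ → ℕ → Set
  NumberOfOrbits H S k = Bijection (OrbitSetoid H S) (FinSetoid k)

  IsOrbit : PermGroup X → Pred Carrier 0ℓ → Set
  IsOrbit H S = ∃[ x ] (∀ y → y ∈ S ⇔ SameOrbit H x y)

  -- Invariance has to be demanded, since H acts on all of X; S may be empty.
  TransitiveOn : PermGroup X → Pred Carrier 0ℓ → Set
  TransitiveOn H S = (∀ h x → h ∈ Member H → x ∈ S → h ⟨$⟩ x ∈ S)
                   × (∀ x y → x ∈ S → y ∈ S → SameOrbit H x y)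

  -- The pairs are those (ι a , κ b) with R a b.
  TransitiveOnPairs : PermGroup X → {A B : Set} → (A → Carrier) → (B → Carrier) →
                      REL A B 0ℓ → Set
  TransitiveOnPairs H ι κ R = ∀ a b a′ b′ → R a b → R a′ b′ →
    ∃[ h ] (h ∈ Member H × h ⟨$⟩ ι a ≈ ι a′ × h ⟨$⟩ κ b ≈ κ b′)

  RegularOn : PermGroup X → Pred Carrier 0ℓ → Set
  RegularOn H S = TransitiveOn H S
    × (∀ h x → h ∈ Member H → x ∈ S → h ⟨$⟩ x ≈ x → ∀ y → h ⟨$⟩ y ≈ y)

  Stabiliser : PermGroup X → Carrier → PermGroup X
  Stabiliser H x = record
    { Member    = λ h → h ∈ Member H × h ⟨$⟩ x ≈ x
    ; resp      = λ { g≈h (g∈H , gx≈x) → Subgroup.resp H g≈h g∈H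
                    , trans (sym (g≈h x)) gx≈x }
    ; ε-closed  = Subgroup.ε-closed H , refl
    ; ∙-closed  = λ { {g} (g∈H , gx≈x) (h∈H , hx≈x) → Subgroup.∙-closed H g∈H h∈H
                    , trans (Inverse.to-cong g hx≈x) gx≈x }
    ; ⁻¹-closed = λ { {g} (g∈H , gx≈x) → Subgroup.⁻¹-closed H g∈H
                    , trans (Inverse.from-cong g (sym gx≈x)) (Inverse.strictlyInverseʳ g x) }
    }

  HasRank : PermGroup X → ℕ → Set
  HasRank H k = TransitiveOn H U × (∀ x → NumberOfOrbits (Stabiliser H x) U k)

record Graph : Set₁ where
  field
    Vertices : Setoid 0ℓ 0ℓ
  open Setoid Vertices public using () renaming (Carrier to Vertex; _≈_ to _≈ᵥ_)
  field
    _~_      : Rel Vertex 0ℓ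
    ~-resp   : _~_ Respects₂ _≈ᵥ_
    ~-sym    : Symmetric _~_
    ~-irrefl : Irreflexive _≈ᵥ_ _~_

module _ (Γ : Graph) where
  open Graph Γ

  data Walk : ℕ → Rel Vertex 0ℓ where
    nil  : ∀ {u v} → u ≈ᵥ v → Walk zero u v
    cons : ∀ {k u w v} → u ~ w → Walk k w v → Walk (suc k) u v

  IsConnected : Set
  IsConnected = ∀ u v → ∃[ k ] Walk k u v

  Distance : Vertex → Vertex → ℕ → Set
  Distance u v k = Walk k u v × (∀ j → j ℕ.< k → ¬ Walk j u v)

  HasDiameter : ℕ → Set
  HasDiameter δ = (∃[ u ] ∃[ v ] Distance u v δ)
                × (∀ u v k → Distance u v k → k ℕ.≤ δ)

IsGraphIsomorphism : (Γ Δ : Graph) → Inverse (Graph.Vertices Γ) (Graph.Vertices Δ) → Set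
IsGraphIsomorphism Γ Δ φ = ∀ u v → Γ._~_ u v ⇔ Δ._~_ (φ ⟨$⟩ u) (φ ⟨$⟩ v)
  where module Γ = Graph Γ
        module Δ = Graph Δ

ActsOnGraph : (Γ : Graph) → PermGroup (Graph.Vertices Γ) → Set
ActsOnGraph Γ G = ∀ g → g ∈ Member G → IsGraphIsomorphism Γ Γ g

record LocallyDistanceTransitive (Γ : Graph) (G : PermGroup (Graph.Vertices Γ)) (s : ℕ) : Set where
  field
    diameter≥s : ∃[ δ ] (HasDiameter Γ δ × s ℕ.≤ δ)
    G≤Aut      : ActsOnGraph Γ G
    transitive : ∀ v i → 1 ℕ.≤ i → i ℕ.≤ s →
                 TransitiveOn (Stabiliser G v) (λ w → Distance Γ v w i)

record BipartiteGraph : Set₁ where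
  field
    B B′ : Setoid 0ℓ 0ℓ
  open Setoid B  using () renaming (Carrier to X; _≈_ to _≈₁_)
  open Setoid B′ using () renaming (Carrier to Y; _≈_ to _≈₂_)
  field
    _—_    : REL X Y 0ℓ
    —-resp : ∀ {x x′ y y′} → x ≈₁ x′ → y ≈₂ y′ → x — y → x′ — y′

  graph : Graph
  graph = record
    { Vertices = B ⊎ₛ B′
    ; _~_      = _~_
    ; ~-resp   = (λ {u} → respʳ {u}) , (λ {u} → respˡ {u})
    ; ~-sym    = λ {u} {v} → ~-sym {u} {v}
    ; ~-irrefl = irrefl
    }
    where
    open Setoid (B ⊎ₛ B′) using (_≈_)

    _~_ : Rel (X ⊎ Y) 0ℓ
    inj₁ x ~ inj₂ y = x — y
    inj₂ y ~ inj₁ x = x — y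
    inj₁ _ ~ inj₁ _ = ⊥
    inj₂ _ ~ inj₂ _ = ⊥

    ~-sym : Symmetric _~_
    ~-sym {inj₁ _} {inj₂ _} e = e
    ~-sym {inj₂ _} {inj₁ _} e = e

    respʳ : ∀ {u v w} → v ≈ w → u ~ v → u ~ w
    respʳ {inj₁ _} (inj₂ q) e = —-resp (Setoid.refl B) q e
    respʳ {inj₂ _} (inj₁ q) e = —-resp q (Setoid.refl B′) e

    respˡ : ∀ {u v w} → v ≈ w → v ~ u → w ~ u
    respˡ {inj₂ _} (inj₁ q) e = —-resp q (Setoid.refl B′) e
    respˡ {inj₁ _} (inj₂ q) e = —-resp (Setoid.refl B) q e

    irrefl : Irreflexive _≈_ _~_
    irrefl (inj₁ _) ()
    irrefl (inj₂ _) ()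

  open Graph graph public

-- Decidability of adjacency is automatic classically.
record IsFiniteBipartite (Γ : BipartiteGraph) : Set where
  open BipartiteGraph Γ
  field
    B-finite  : IsFinite B
    B′-finite : IsFinite B′
    _—?_      : Decidable _—_

record Starlike (Γ : BipartiteGraph) (N : PermGroup (BipartiteGraph.Vertices Γ)) (r : ℕ) : Set where
  open BipartiteGraph Γ
  field
    connected       : IsConnected graph
    N≤Aut           : ActsOnGraph graph N
    r≥2             : 2 ℕ.≤ r
    transitive-on-B : TransitiveOn N OnLeft
    orbits-on-B′    : NumberOfOrbits N OnRight r

record _≅ᵍ_ (Γ Δ : BipartiteGraph) : Set where
  private
    module Γ = BipartiteGraph Γ
    module Δ = BipartiteGraph Δ
  field
    φ                  : Inverse Γ.Vertices Δ.Vertices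
    isGraphIsomorphism : IsGraphIsomorphism Γ.graph Δ.graph φ
    maps-B             : ∀ u → u ∈ OnLeft ⇔ φ ⟨$⟩ u ∈ OnLeft
    maps-B′            : ∀ u → u ∈ OnRight ⇔ φ ⟨$⟩ u ∈ OnRight

record Design : Set₁ where
  field
    Points Blocks : Setoid 0ℓ 0ℓ
  open Setoid Points public using () renaming (Carrier to Point; _≈_ to _≈ₚ_)
  open Setoid Blocks public using () renaming (Carrier to Block; _≈_ to _≈ᵦ_)
  field
    _I_    : REL Point Block 0ℓ
    I-resp : ∀ {x y α β} → x ≈ₚ y → α ≈ᵦ β → x I α → y I β

  Elements : Setoid 0ℓ 0ℓ
  Elements = Points ⊎ₛ Blocks

  Incident : Rel (Point ⊎ Block) 0ℓ
  Incident (inj₁ x) (inj₂ β) = x I β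
  Incident _        _        = ⊥

  Collinear NonCollinear : Rel Point 0ℓ
  Collinear    x y = ¬ x ≈ₚ y × ∃[ β ] (x I β × y I β)
  NonCollinear x y = ¬ x ≈ₚ y × ¬ (∃[ β ] (x I β × y I β))

  Intersecting NonIntersecting : Rel Block 0ℓ
  Intersecting    α β = ¬ α ≈ᵦ β × ∃[ x ] (x I α × x I β)
  NonIntersecting α β = ¬ α ≈ᵦ β × ¬ (∃[ x ] (x I α × x I β))

record IsDesignIsomorphism (D E : Design) (φ : Inverse (Design.Elements D) (Design.Elements E)) : Set where
  private
    module D = Design D
    module E = Design E
  field
    maps-points        : ∀ u → u ∈ OnLeft ⇔ φ ⟨$⟩ u ∈ OnLeft
    maps-blocks        : ∀ u → u ∈ OnRight ⇔ φ ⟨$⟩ u ∈ OnRight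
    preserves-incident : ∀ u v → D.Incident u v ⇔ E.Incident (φ ⟨$⟩ u) (φ ⟨$⟩ v)

_≅ᵈ_ : Design → Design → Set
D ≅ᵈ E = ∃[ φ ] IsDesignIsomorphism D E φ

ActsOnDesign : (D : Design) → PermGroup (Design.Elements D) → Set
ActsOnDesign D G = ∀ g → g ∈ Member G → IsDesignIsomorphism D D g

record PairwiseTransitive (D : Design) (G : PermGroup (Design.Elements D)) : Set where
  open Design D
  field
    G≤Aut           : ActsOnDesign D G
    incident        : TransitiveOnPairs G inj₁ inj₂ _I_
    nonIncident     : TransitiveOnPairs G inj₁ inj₂ (λ x β → ¬ x I β)
    collinear       : TransitiveOnPairs G inj₁ inj₁ Collinear
    nonCollinear    : TransitiveOnPairs G inj₁ inj₁ NonCollinear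
    intersecting    : TransitiveOnPairs G inj₂ inj₂ Intersecting
    nonIntersecting : TransitiveOnPairs G inj₂ inj₂ NonIntersecting

record NicelyAffine (D : Design) (N : PermGroup (Design.Elements D)) : Set where
  open Design D
  field
    N≤Aut                : ActsOnDesign D N
    transitive-on-points : TransitiveOn N OnLeft
    μ                    : ℕ
    different-orbits     : ∀ α β → ¬ α ≈ᵦ β → ¬ SameOrbit N (inj₂ α) (inj₂ β) →
                           HasSize Points (λ x → x I α × x I β) μ
    same-orbit           : ∀ α β → ¬ α ≈ᵦ β → SameOrbit N (inj₂ α) (inj₂ β) →
                           ∀ x → ¬ (x I α × x I β)

NumberOfParallelClasses : (D : Design) → PermGroup (Design.Elements D) → ℕ → Set
NumberOfParallelClasses D N = NumberOfOrbits N OnRight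

adjacencyDesign : BipartiteGraph → Design
adjacencyDesign Γ = record { Points = B ; Blocks = B′ ; _I_ = _—_ ; I-resp = —-resp }
  where open BipartiteGraph Γ

incidenceGraph : Design → BipartiteGraph
incidenceGraph D = record { B = Points ; B′ = Blocks ; _—_ = _I_ ; —-resp = I-resp }
  where open Design D

-- V(d, p) in coordinates over the residues mod p, a field when p is prime.
module VectorSpace (p d : ℕ) .{{_ : NonZero p}} where

  𝔽 : Set
  𝔽 = Fin p

  _+𝔽_ _*𝔽_ : 𝔽 → 𝔽 → 𝔽
  a +𝔽 b = (toℕ a ℕ.+ toℕ b) mod p
  a *𝔽 b = (toℕ a ℕ.* toℕ b) mod p

  V : Set
  V = Vec 𝔽 d

  VSetoid : Setoid 0ℓ 0ℓ
  VSetoid = ≡.setoid V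

  infixl 6 _+ᵛ_
  infixr 7 _·ᵛ_

  0ᵛ : V
  0ᵛ = replicate d (0 mod p)

  _+ᵛ_ : V → V → V
  _+ᵛ_ = zipWith _+𝔽_

  _·ᵛ_ : 𝔽 → V → V
  a ·ᵛ v = map (a *𝔽_) v

  record Subspace : Set₁ where
    field
      Vector   : Pred V 0ℓ
      0-closed : 0ᵛ ∈ Vector
      +-closed : ∀ {v w} → v ∈ Vector → w ∈ Vector → v +ᵛ w ∈ Vector
      ·-closed : ∀ a {v} → v ∈ Vector → a ·ᵛ v ∈ Vector

  open Subspace public using (Vector)

  _+ˢ_ : Subspace → Subspace → Pred V 0ℓ
  (S +ˢ T) x = ∃[ s ] ∃[ t ] (s ∈ Vector S × t ∈ Vector T × x ≡ s +ᵛ t)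

  Coset : V → Subspace → Pred V 0ℓ
  Coset v S x = ∃[ s ] (s ∈ Vector S × x ≡ v +ᵛ s)

  IsLinear : Perm VSetoid → Set
  IsLinear g = (∀ v w → g ⟨$⟩ (v +ᵛ w) ≡ (g ⟨$⟩ v) +ᵛ (g ⟨$⟩ w))
             × (∀ a v → g ⟨$⟩ (a ·ᵛ v) ≡ a ·ᵛ (g ⟨$⟩ v))

  -- g(S) = T, as g is a bijection.
  Sends : Perm VSetoid → Pred V 0ℓ → Pred V 0ℓ → Set
  Sends g S T = ∀ x → x ∈ S ⇔ g ⟨$⟩ x ∈ T

record VectorSpaceConstruction (p d r : ℕ) .{{_ : NonZero p}} : Set₁ where
  open VectorSpace p d
  field
    Ĝ₀        : PermGroup VSetoid
    Ĝ₀-linear : ∀ g → g ∈ Member Ĝ₀ → IsLinear g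

    -- Ĝ = N̂Ĝ₀, with N̂ the group of translations.
    Ĝ         : PermGroup VSetoid
    Ĝ-product : ∀ g → g ∈ Member Ĝ ⇔
                (∃[ v ] ∃[ h ] (h ∈ Member Ĝ₀ × (∀ x → g ⟨$⟩ x ≡ v +ᵛ (h ⟨$⟩ x))))

    rank2or3  : HasRank Ĝ 2 ⊎ HasRank Ĝ 3

    3≤r        : 3 ℕ.≤ r
    M          : Fin r → Subspace
    -- So the orbit {M₁, …, M_r} has exactly r members.
    M-distinct : ∀ i j → Vector (M i) ≐ Vector (M j) → i ≡ j

  M₁ : Subspace
  M₁ = M (inject≤ 0F 3≤r)

  M₂ : Subspace
  M₂ = M (inject≤ 1F 3≤r)

  field
    M-invariant  : ∀ g i → g ∈ Member Ĝ₀ → ∃[ j ] Sends g (Vector (M i)) (Vector (M j))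
    M-transitive : ∀ i j → ∃[ g ] (g ∈ Member Ĝ₀ × Sends g (Vector (M i)) (Vector (M j)))
    M-2-transitive : ∀ i j k l → i ≢ j → k ≢ l →
      ∃[ g ] (g ∈ Member Ĝ₀ × Sends g (Vector (M i)) (Vector (M k))
                            × Sends g (Vector (M j)) (Vector (M l)))

    V≡M₁+M₂ : ∀ v → v ∈ M₁ +ˢ M₂

    V/M₁-transitive : ∀ v w → v ∉ Vector M₁ → w ∉ Vector M₁ →
      ∃[ g ] (g ∈ Member Ĝ₀ × Sends g (Vector M₁) (Vector M₁)
                            × Sends g (Coset v M₁) (Coset w M₁))

    ⋃M*-orbit : IsOrbit Ĝ₀ (λ v → ∃[ i ] (v ∈ Vector (M i) × v ≢ 0ᵛ))

  -- (i , v) stands for the block v + M i; blocks are compared as subsets of V.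
  blockSetoid : Setoid 0ℓ 0ℓ
  blockSetoid = record
    { Carrier       = Fin r × V
    ; _≈_           = λ { (i , v) (j , w) → Coset v (M i) ≐ Coset w (M j) }
    ; isEquivalence = record { refl = ≐-refl ; sym = ≐-sym ; trans = ≐-trans }
    }

  design : Design
  design = record
    { Points = VSetoid
    ; Blocks = blockSetoid
    ; _I_    = λ { x (i , v) → x ∈ Coset v (M i) }
    ; I-resp = λ { ≡.refl v+M≐w+M x∈v+M → proj₁ v+M≐w+M x∈v+M }
    }

ObtainedFromVectorSpace : BipartiteGraph → ℕ → Set₁
ObtainedFromVectorSpace Γ r =
  ∃[ p ] ∃[ d ] Σ[ p-prime ∈ Prime p ]
    (let instance p≢0 : NonZero p
                  p≢0 = prime⇒nonZero p-prime
     in Σ[ C ∈ VectorSpaceConstruction p d r ]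
          ((Γ ≅ᵍ incidenceGraph (VectorSpaceConstruction.design C))
          × (adjacencyDesign Γ ≅ᵈ VectorSpaceConstruction.design C)))

{-# OPTIONS --safe #-}
-- Identify the points with N through a base point o. The blocks through o become subgroups P i of N, one for each
-- parallel class, all blocks are left cosets of these, and N = P i · P j for i ≠ j because non-parallel blocks meet.
-- The stabiliser G₀ of o acts by automorphisms: it permutes the P i transitively, is transitive on the nontrivial
-- elements of ⋃ P i (collinear pairs), and for each i on the cosets xP i ≠ P i (non-incident pairs).
--
-- By Cauchy's theorem |P i| is a power of a prime p, and so is [N : P i], which divides |P i|. The orbits of P i on its
-- nontrivial left cosets all have one size, dividing |P i| and [N : P i] − 1, so it is 1 and P i is normal. The same count
-- for conjugation by N on N / P i shows that N / P i is abelian. Hence all commutators lie in ⋂ P i; a nontrivial one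
-- would have images covering ⋃ P i, and the P i would all be equal to N, against diameter ≥ 4. So N is abelian,
-- generated by elements of order p, and coordinates with respect to a basis turn the P i into the subspaces M i.
module Submission where

open import Defs

open import Algebra.Bundles using (CommutativeMonoid; Group)
open import Algebra.Core using (Op₁; Op₂)
open import Algebra.Definitions using (Commutative)
import Algebra.Definitions.RawMonoid as RawMonoidDefinitions
import Algebra.Properties.CommutativeMonoid.Mult
import Algebra.Properties.CommutativeSemigroup as CommutativeSemigroup
import Algebra.Properties.Group
import Algebra.Properties.Monoid.Mult
open import Algebra.Structures using (IsGroup)
open import Data.Bool.Base using (true; false; if_then_else_)
open import Data.Empty using (⊥; ⊥-elim)
open import Data.Fin.Base as Fin using (Fin; inject≤; inject₁)
open import Data.Fin.Patterns using (0F; 1F; 2F)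
import Data.Fin.Properties as Fin
open import Data.List.Base as List using (List; []; _∷_; _++_; allFin; concatMap)
open import Data.List.Membership.Propositional using (lose)
import Data.List.Properties as List
open import Data.List.Relation.Unary.Any using (Any; any?; here; there; satisfied)
open import Data.Nat.Base as ℕ using (ℕ; zero; suc; _+_; _*_; _∸_; _%_; _<_; _≤_; s≤s; z≤n; NonZero; nonTrivial⇒≢1)
open import Data.Nat.Coprimality using (Coprime; coprime-Bézout; prime⇒coprime)
open import Data.Nat.Divisibility
  using (_∣_; divides; ∣m∣n⇒∣m+n; ∣m+n∣m⇒∣n; ∣1⇒≡1; ∣-refl; ∣-trans; _∣0; ∣m⇒∣m*n; ∣n⇒∣m*n)
open import Data.Nat.DivMod using (m≡m%n+[m/n]*n; m%n<n; _mod_; _/_)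
open import Data.Nat.GCD using (module Bézout)
open import Data.Nat.Induction using (<-rec; <-wellFounded)
open import Data.Nat.ListAction using (sum)
open import Data.Nat.ListAction.Properties using (sum-++)
open import Data.Nat.Primality
  using (Prime; prime?; prime[2]; prime⇒nonZero; prime⇒irreducible; ¬prime[1]; ¬prime⇒composite; composite; euclidsLemma)
open import Data.Nat.Properties hiding (_≟_)
import Data.Nat.Properties as ℕ
open import Data.Product.Base using (Σ-syntax; ∃; ∃-syntax; _×_; _,_; proj₁; proj₂)
open import Data.Sum.Base using (_⊎_; inj₁; inj₂; [_,_]′)
open import Data.Sum.Relation.Binary.Pointwise as Pointwise using (_⊎ₛ_; inj₁; inj₂)
open import Data.Unit.Base using (tt)
open import Data.Vec.Base as Vec using (Vec; []; _∷_; _∷ʳ_)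
import Data.Vec.Properties as Vec
open import Data.Vec.Relation.Unary.All as All using (All; []; _∷_)
open import Function.Base using (_∘_; id; case_of_)
open import Function.Bundles using (Inverse; Bijection; Equivalence; _⇔_; mk⇔)
open import Function.Definitions using (Injective)
open import Induction.WellFounded using (Acc; acc)
open import Level using (0ℓ)
open import Relation.Binary.Bundles using (Setoid)
open import Relation.Binary.Core using (Rel; REL)
open import Relation.Binary.Definitions using (DecidableEquality; tri<; tri≈; tri>)
open import Relation.Binary.PropositionalEquality
open import Relation.Binary.Structures using (IsEquivalence)
open import Relation.Nullary.Decidable
  using (Dec; does; yes; no; _×-dec_; ¬?; map′; dec-true; dec-false; decidable-stable)
open import Relation.Nullary.Negation using (¬_; contradiction)
open import Relation.Unary using (Pred; Decidable; ∁; U; _∈_; _∉_; _≐_)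
open import Relation.Unary.Properties using (_∩?_; ∁?; U?)

-- Counting in finite types

-- The two orbit counts of the overview are one argument. For x in `P i` the cosets xaP and xax⁻¹P
-- of P = `P i` coincide, so left multiplication by `P i` on its cosets is conjugation; the steps
-- differ only in the conjugating subgroup L, which is `P i` itself at first and all of N once `P i`
-- is known to be normal. Nontrivial orbits have one size because `G₀` acts by automorphisms that
-- preserve `P i` and L and fuse all nontrivial cosets. That the index u divides |P i| comes from |P
-- i| · |P j| = |N| · |P i ∩ P j| together with |P i| = |P j|.
--
-- No prime power is ever written down. Two facts take its place: all prime divisors of |P i| agree,
-- and those of u and |N| are among them. An orbit length s > 1 would share a prime with u, although
-- s divides u - 1.
--
-- Cosets are not collected into a quotient either: counts run over group elements, so an orbit of s
-- cosets appears as a set of s · |P i| elements. Vertices are replaced by indices in `Fin`, which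
-- makes the predicates to be counted decidable.

𝟙 : {P : Set} → Dec P → ℕ
𝟙 P? = if does P? then 1 else 0

𝟙-true : {P : Set} (P? : Dec P) → P → 𝟙 P? ≡ 1
𝟙-true P? p rewrite dec-true P? p = refl

𝟙-false : {P : Set} (P? : Dec P) → ¬ P → 𝟙 P? ≡ 0
𝟙-false P? ¬p rewrite dec-false P? ¬p = refl

𝟙-cong : {P Q : Set} (P? : Dec P) (Q? : Dec Q) → (P → Q) → (Q → P) → 𝟙 P? ≡ 𝟙 Q?
𝟙-cong P? (yes q) _ to = 𝟙-true P? (to q)
𝟙-cong P? (no ¬q) f _  = 𝟙-false P? (¬q ∘ f)

𝟙-× : {P Q : Set} (P? : Dec P) (Q? : Dec Q) → 𝟙 (P? ×-dec Q?) ≡ 𝟙 P? * 𝟙 Q?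
𝟙-× P? Q? with does P? | does Q?
... | true  | true  = refl
... | true  | false = refl
... | false | _     = refl

𝟙-split : {P Q : Set} (P? : Dec P) (Q? : Dec Q) →
          𝟙 P? ≡ 𝟙 (P? ×-dec Q?) + 𝟙 (P? ×-dec ¬? Q?)
𝟙-split P? Q? with does P? | does Q?
... | true  | true  = refl
... | true  | false = refl
... | false | _     = refl

∑ : {A : Set} → List A → (A → ℕ) → ℕ
∑ xs f = sum (List.map f xs)

∑-cong : {A : Set} (xs : List A) {f g : A → ℕ} → (∀ x → f x ≡ g x) → ∑ xs f ≡ ∑ xs g
∑-cong []       f≗g = refl
∑-cong (x ∷ xs) f≗g = cong₂ _+_ (f≗g x) (∑-cong xs f≗g)

∑-0 : {A : Set} (xs : List A) → ∑ xs (λ _ → 0) ≡ 0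
∑-0 []       = refl
∑-0 (_ ∷ xs) = ∑-0 xs

∑-+ : {A : Set} (xs : List A) (f g : A → ℕ) → ∑ xs (λ x → f x + g x) ≡ ∑ xs f + ∑ xs g
∑-+ []       f g = refl
∑-+ (x ∷ xs) f g = trans (cong ((f x + g x) +_) (∑-+ xs f g)) (interchange (f x) (g x) (∑ xs f) (∑ xs g))
  where open CommutativeSemigroup +-commutativeSemigroup using (interchange)

∑-*ˡ : {A : Set} (xs : List A) (c : ℕ) (f : A → ℕ) → ∑ xs (λ x → c * f x) ≡ c * ∑ xs f
∑-*ˡ []       c f = sym (*-zeroʳ c)
∑-*ˡ (x ∷ xs) c f = trans (cong (c * f x +_) (∑-*ˡ xs c f)) (sym (*-distribˡ-+ c (f x) _))

∑-*ʳ : {A : Set} (xs : List A) (c : ℕ) (f : A → ℕ) → ∑ xs (λ x → f x * c) ≡ ∑ xs f * c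
∑-*ʳ xs c f = trans (∑-cong xs λ x → *-comm (f x) c) (trans (∑-*ˡ xs c f) (*-comm c _))

∑-swap : {A B : Set} (xs : List A) (ys : List B) (f : A → B → ℕ) →
         ∑ xs (λ x → ∑ ys (f x)) ≡ ∑ ys (λ y → ∑ xs (λ x → f x y))
∑-swap []       ys f = sym (∑-0 ys)
∑-swap (x ∷ xs) ys f = trans (cong (∑ ys (f x) +_) (∑-swap xs ys f))
                             (sym (∑-+ ys (f x) (λ y → ∑ xs (λ x → f x y))))

∑-map : {A B : Set} (xs : List A) (h : A → B) (f : B → ℕ) → ∑ (List.map h xs) f ≡ ∑ xs (f ∘ h)
∑-map xs h f = cong sum (sym (List.map-∘ xs))

∑-concatMap : {A B : Set} (xs : List A) (h : A → List B) (f : B → ℕ) →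
              ∑ (concatMap h xs) f ≡ ∑ xs (λ x → ∑ (h x) f)
∑-concatMap []       h f = refl
∑-concatMap (x ∷ xs) h f = trans (cong sum (List.map-++ f (h x) _))
  (trans (sum-++ (List.map f (h x)) _) (cong (∑ (h x) f +_) (∑-concatMap xs h f)))

-- `once` expresses in a single equation that the list is complete and free of repetitions, in the
-- form in which a sum over one matching element is evaluated.
record Finite (A : Set) : Set where
  infix 4 _≟_
  field
    _≟_      : DecidableEquality A
    elements : List A
    once     : ∀ a → ∑ elements (λ b → 𝟙 (a ≟ b)) ≡ 1

open Finite using (elements)

module _ {A : Set} (F : Finite A) where
  open Finite F using (_≟_; once)

  ∈-elements : ∀ a → Any (a ≡_) (elements F)
  ∈-elements a = nonzero (elements F) (once a)
    where
    nonzero : ∀ xs → ∑ xs (λ b → 𝟙 (a ≟ b)) ≡ 1 → Any (a ≡_) xs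
    nonzero (x ∷ xs) e with a ≟ x
    ... | yes a≡x = here a≡x
    ... | no  _   = there (nonzero xs e)

  ∃? : {P : Pred A 0ℓ} → Decidable P → Dec (∃ P)
  ∃? P? = map′ satisfied (λ { (a , Pa) → lose (∈-elements a) Pa }) (any? P? (elements F))

  count : {P : Pred A 0ℓ} → Decidable P → ℕ
  count P? = ∑ (elements F) (λ a → 𝟙 (P? a))

  module _ {P Q : Pred A 0ℓ} (P? : Decidable P) (Q? : Decidable Q) where

    count-cong : (∀ {a} → P a → Q a) → (∀ {a} → Q a → P a) → count P? ≡ count Q?
    count-cong f g = ∑-cong (elements F) λ a → 𝟙-cong (P? a) (Q? a) f g

    count-split : count P? ≡ count (P? ∩? Q?) + count (P? ∩? ∁? Q?)
    count-split = trans (∑-cong (elements F) λ a → 𝟙-split (P? a) (Q? a)) (∑-+ (elements F) _ _)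

  module _ {P : Pred A 0ℓ} (P? : Decidable P) {a : A} (Pa : P a) where

    count-unique : (∀ {b} → P b → b ≡ a) → count P? ≡ 1
    count-unique unique = trans
      (∑-cong (elements F) λ b → 𝟙-cong (P? b) (a ≟ b) (sym ∘ unique) (λ { refl → Pa }))
      (once a)

    count-positive : 1 ≤ count P?
    count-positive = positive (elements F) (∈-elements a)
      where
      positive : ∀ xs → Any (a ≡_) xs → 1 ≤ ∑ xs (λ b → 𝟙 (P? b))
      positive (x ∷ xs) (here refl) rewrite 𝟙-true (P? x) Pa = s≤s z≤n
      positive (x ∷ xs) (there a∈xs) = ≤-trans (positive xs a∈xs) (m≤n+m _ (𝟙 (P? x)))

module _ {A B : Set} (F : Finite A) (E : Finite B)
         {S : Pred A 0ℓ} {T : Pred B 0ℓ} (S? : Decidable S) (T? : Decidable T) where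

  -- Both sides are the number of pairs (a, b) with `S a`, `T b` and `R a b`. Bijections, orbit
  -- lengths, orbit-stabiliser and the product formula for subgroups are all instances.
  double-count : {R : REL A B 0ℓ} (R? : ∀ a b → Dec (R a b)) {c d : ℕ} →
                 (∀ a → S a → count E (T? ∩? R? a) ≡ c) →
                 (∀ b → T b → count F (S? ∩? (λ a → R? a b)) ≡ d) →
                 count F S? * c ≡ count E T? * d
  double-count R? {c} {d} rows columns = begin
    count F S? * c
      ≡⟨ ∑-*ʳ xs c _ ⟨
    ∑ xs (λ a → 𝟙 (S? a) * c)
      ≡⟨ ∑-cong xs row ⟩
    ∑ xs (λ a → ∑ ys (λ b → 𝟙 (S? a) * (𝟙 (T? b) * 𝟙 (R? a b))))
      ≡⟨ ∑-swap xs ys _ ⟩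
    ∑ ys (λ b → ∑ xs (λ a → 𝟙 (S? a) * (𝟙 (T? b) * 𝟙 (R? a b))))
      ≡⟨ ∑-cong ys column ⟩
    ∑ ys (λ b → 𝟙 (T? b) * d)
      ≡⟨ ∑-*ʳ ys d _ ⟩
    count E T? * d ∎
    where
    open ≡-Reasoning
    xs = elements F
    ys = elements E

    -- Row and column counts are known only on `S` and `T`; elsewhere the factor `𝟙` is 0 and any
    -- value will do.
    restrict : {P : Set} (P? : Dec P) {m n : ℕ} → (P → n ≡ m) → 𝟙 P? * m ≡ 𝟙 P? * n
    restrict (yes p) e = cong (_+ 0) (sym (e p))
    restrict (no _)  _ = refl

    row : ∀ a → 𝟙 (S? a) * c ≡ ∑ ys (λ b → 𝟙 (S? a) * (𝟙 (T? b) * 𝟙 (R? a b)))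
    row a = trans (restrict (S? a) (rows a)) (trans
      (cong (𝟙 (S? a) *_) (∑-cong ys λ b → 𝟙-× (T? b) (R? a b)))
      (sym (∑-*ˡ ys (𝟙 (S? a)) _)))

    open CommutativeSemigroup *-commutativeSemigroup using (x∙yz≈y∙xz)

    column : ∀ b → ∑ xs (λ a → 𝟙 (S? a) * (𝟙 (T? b) * 𝟙 (R? a b))) ≡ 𝟙 (T? b) * d
    column b = sym (trans (restrict (T? b) (columns b)) (trans
      (cong (𝟙 (T? b) *_) (∑-cong xs λ a → 𝟙-× (S? a) (R? a b)))
      (trans (sym (∑-*ˡ xs (𝟙 (T? b)) _))
             (∑-cong xs λ a → x∙yz≈y∙xz (𝟙 (T? b)) (𝟙 (S? a)) (𝟙 (R? a b))))))

  -- The graph of `f` has one pair in each row and each column. The maps are inverse to each other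
  -- only on `S` and `T`, so total functions can stand in for maps between subtypes.
  count-bijection : (f : A → B) (g : B → A) →
                    (∀ {a} → S a → T (f a)) → (∀ {b} → T b → S (g b)) →
                    (∀ {a} → S a → g (f a) ≡ a) → (∀ {b} → T b → f (g b) ≡ b) →
                    count F S? ≡ count E T?
  count-bijection f g S⇒T T⇒S gf fg = begin
    count F S?     ≡⟨ *-identityʳ _ ⟨
    count F S? * 1 ≡⟨ double-count (λ a b → f a ≟ b)
                        (λ a s → count-unique E (T? ∩? (f a ≟_)) (S⇒T s , refl) (sym ∘ proj₂))
                        (λ b t → count-unique F (S? ∩? λ a → f a ≟ b) (T⇒S t , fg t)
                                   (λ { (s , refl) → sym (gf s) })) ⟩
    count E T? * 1 ≡⟨ *-identityʳ _ ⟩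
    count E T?     ∎
    where
    open ≡-Reasoning
    open Finite E using (_≟_)

module _ {A : Set} (F : Finite A) {_∼_ : Rel A 0ℓ}
         (∼-equiv : IsEquivalence _∼_) (_∼?_ : ∀ a b → Dec (a ∼ b)) {c : ℕ} where
  private module ∼ = IsEquivalence ∼-equiv

  -- Remove one class at a time.
  classes-divide : {S : Pred A 0ℓ} (S? : Decidable S) →
                   (∀ {a b} → a ∼ b → S a → S b) →
                   (∀ {a} → S a → count F (a ∼?_) ≡ c) →
                   c ∣ count F S?
  classes-divide S? closed size = go S? closed size (<-wellFounded _)
    where
    go : {S : Pred A 0ℓ} (S? : Decidable S) → (∀ {a b} → a ∼ b → S a → S b) →
         (∀ {a} → S a → count F (a ∼?_) ≡ c) → Acc _<_ (count F S?) → c ∣ count F S?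
    go {S} S? closed size (acc rec) with ∃? F S?
    ... | no ¬∃ = subst (c ∣_) (sym empty) (c ∣0)
      where
      empty : count F S? ≡ 0
      empty = trans (∑-cong (elements F) λ a → 𝟙-false (S? a) λ s → ¬∃ (a , s)) (∑-0 (elements F))
    ... | yes (a , s) = subst (c ∣_) (sym split)
            (∣m∣n⇒∣m+n ∣-refl (go S′? closed′ (size ∘ proj₁) (rec smaller)))
      where
      S′? = S? ∩? ∁? (a ∼?_)

      closed′ : ∀ {x y} → x ∼ y → S x × ¬ a ∼ x → S y × ¬ a ∼ y
      closed′ x∼y (sx , a≁x) = closed x∼y sx , λ a∼y → a≁x (∼.trans a∼y (∼.sym x∼y))

      split : count F S? ≡ c + count F S′?
      split = trans (count-split F S? (a ∼?_)) (cong (_+ count F S′?) (trans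
        (count-cong F (S? ∩? (a ∼?_)) (a ∼?_) proj₂ (λ a∼b → closed a∼b s , a∼b)) (size s)))

      smaller : count F S′? < count F S?
      smaller = subst (count F S′? <_) (sym split)
        (+-monoˡ-≤ (count F S′?) (subst (1 ≤_) (size s) (count-positive F (a ∼?_) ∼.refl)))

finite-Fin : ∀ n → Finite (Fin n)
finite-Fin n = record { _≟_ = Fin._≟_ ; elements = allFin n ; once = once n }
  where
  ∑-allFin-suc : ∀ n (f : Fin (suc n) → ℕ) →
                 ∑ (allFin (suc n)) f ≡ f Fin.zero + ∑ (allFin n) (f ∘ Fin.suc)
  ∑-allFin-suc n f = cong (λ xs → f Fin.zero + sum xs)
    (trans (List.map-tabulate Fin.suc f) (sym (List.map-tabulate id (f ∘ Fin.suc))))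

  once : ∀ n (a : Fin n) → ∑ (allFin n) (λ b → 𝟙 (a Fin.≟ b)) ≡ 1
  once (suc n) Fin.zero    = trans (∑-allFin-suc n λ b → 𝟙 (Fin.zero {n} Fin.≟ b)) (cong suc (∑-0 (allFin n)))
  once (suc n) (Fin.suc a) = trans (∑-allFin-suc n λ b → 𝟙 (Fin.suc a Fin.≟ b)) (trans
    (∑-cong (allFin n) λ b → 𝟙-cong (Fin.suc a Fin.≟ Fin.suc b) (a Fin.≟ b) Fin.suc-injective (cong Fin.suc))
    (once n a))

finite-Vec : {A : Set} → Finite A → ∀ k → Finite (Vec A k)
finite-Vec {A} F k = record { _≟_ = _≟ᵛ_ ; elements = vectors k ; once = once }
  where
  open Finite F using (_≟_)

  _≟ᵛ_ : ∀ {k} → DecidableEquality (Vec A k)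
  _≟ᵛ_ = Vec.≡-dec _≟_

  vectors : ∀ k → List (Vec A k)
  vectors zero    = [] ∷ []
  vectors (suc k) = concatMap (λ a → List.map (a ∷_) (vectors k)) (elements F)

  once : ∀ {k} (v : Vec A k) → ∑ (vectors k) (λ w → 𝟙 (v ≟ᵛ w)) ≡ 1
  once []              = refl
  once {suc k} (a ∷ v) = begin
    ∑ (vectors (suc k)) (λ w → 𝟙 ((a ∷ v) ≟ᵛ w))
      ≡⟨ ∑-concatMap (elements F) _ _ ⟩
    ∑ (elements F) (λ b → ∑ (List.map (b ∷_) (vectors k)) (λ w → 𝟙 ((a ∷ v) ≟ᵛ w)))
      ≡⟨ ∑-cong (elements F) (λ b → ∑-map (vectors k) _ _) ⟩
    ∑ (elements F) (λ b → ∑ (vectors k) (λ w → 𝟙 ((a ∷ v) ≟ᵛ (b ∷ w))))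
      ≡⟨ ∑-cong (elements F) (λ b → trans (∑-cong (vectors k) λ w →
           trans (𝟙-cong ((a ∷ v) ≟ᵛ (b ∷ w)) ((a ≟ b) ×-dec (v ≟ᵛ w))
                   Vec.∷-injective (λ { (refl , refl) → refl }))
                 (𝟙-× (a ≟ b) (v ≟ᵛ w)))
           (trans (∑-*ˡ (vectors k) (𝟙 (a ≟ b)) (λ w → 𝟙 (v ≟ᵛ w))) (trans (cong (𝟙 (a ≟ b) *_) (once v)) (*-identityʳ _)))) ⟩
    ∑ (elements F) (λ b → 𝟙 (a ≟ b))
      ≡⟨ Finite.once F a ⟩
    1 ∎
    where open ≡-Reasoning

-- Orbits of prime length

prime-divisor : ∀ n → n ≢ 1 → ∃[ p ] (Prime p × p ∣ n)
prime-divisor = <-rec _ step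
  where
  step : ∀ n → (∀ {k} → k < n → k ≢ 1 → ∃[ p ] (Prime p × p ∣ k)) → n ≢ 1 → ∃[ p ] (Prime p × p ∣ n)
  step 0             _   _   = 2 , prime[2] , _ ∣0
  step 1             _   n≢1 = contradiction refl n≢1
  step n@(suc (suc _)) rec _ with prime? n
  ... | yes n-prime = n , n-prime , ∣-refl
  ... | no  ¬prime with composite d<n d∣n ← ¬prime⇒composite ¬prime
                 with p , p-prime , p∣d ← rec d<n nonTrivial⇒≢1 = p , p-prime , ∣-trans p∣d d∣n

prime-coprime : ∀ {p q} → Prime p → Prime q → p ≢ q → Coprime p q
prime-coprime p-prime q-prime p≢q (d∣p , d∣q)
  with prime⇒irreducible p-prime d∣p | prime⇒irreducible q-prime d∣q
... | inj₁ d≡1  | _         = d≡1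
... | inj₂ _    | inj₁ d≡1  = d≡1
... | inj₂ refl | inj₂ refl = contradiction refl p≢q

count-U-Fin : ∀ n → count (finite-Fin n) U? ≡ n
count-U-Fin n = trans (∑-1 (allFin n)) (List.length-tabulate id)
  where
  ∑-1 : {A : Set} (xs : List A) → ∑ xs (λ _ → 1) ≡ List.length xs
  ∑-1 []       = refl
  ∑-1 (_ ∷ xs) = cong suc (∑-1 xs)

module _ {X : Set} (ρ : X → X) where

  ρ^ : ℕ → X → X
  ρ^ zero    x = x
  ρ^ (suc i) x = ρ^ i (ρ x)

  ρ^-+ : ∀ i j x → ρ^ (i + j) x ≡ ρ^ j (ρ^ i x)
  ρ^-+ zero    j x = refl
  ρ^-+ (suc i) j x = ρ^-+ i j (ρ x)

  ρ^-* : ∀ i {j x} → ρ^ j x ≡ x → ρ^ (i * j) x ≡ x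
  ρ^-* zero            e = refl
  ρ^-* (suc i) {j} {x} e = trans (ρ^-+ j (i * j) x) (trans (cong (ρ^ (i * j)) e) (ρ^-* i e))

-- Orbits of a map whose q-th iterate is the identity have length 1 or q, so its moved points come
-- in multiples of q. This is the counting step of Cauchy's theorem.
module PrimePeriod {X : Set} (F : Finite X) (ρ : X → X) {q : ℕ} (q-prime : Prime q)
                   (period : ∀ x → ρ^ ρ q x ≡ x) where
  open Finite F using (_≟_)
  private instance _ = prime⇒nonZero q-prime

  _∼_ : Rel X 0ℓ
  x ∼ y = ∃[ i ] ρ^ ρ i x ≡ y

  ∼-equiv : IsEquivalence _∼_
  ∼-equiv = record
    { refl  = 0 , refl
    -- With period q the exponent (q - 1) · i undoes i, so forward iterates alone give a symmetric
    -- relation.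
    ; sym   = λ { {x} (i , refl) → ℕ.pred q * i , (begin
        ρ^ ρ (ℕ.pred q * i) (ρ^ ρ i x) ≡⟨ ρ^-+ ρ i _ x ⟨
        ρ^ ρ (suc (ℕ.pred q) * i) x    ≡⟨ cong (λ k → ρ^ ρ k x) (cong (_* i) (suc-pred q)) ⟩
        ρ^ ρ (q * i) x                 ≡⟨ cong (λ k → ρ^ ρ k x) (*-comm q i) ⟩
        ρ^ ρ (i * q) x                 ≡⟨ ρ^-* ρ i (period x) ⟩
        x                              ∎) }
    ; trans = λ { {x} (i , refl) (j , refl) → i + j , ρ^-+ ρ i j x }
    }
    where open ≡-Reasoning

  reduce : ∀ i x → ρ^ ρ (Fin.toℕ (i mod q)) x ≡ ρ^ ρ i x
  reduce i x = begin
    ρ^ ρ (Fin.toℕ (i mod q)) x              ≡⟨ cong (λ k → ρ^ ρ k x) (Fin.toℕ-fromℕ< (m%n<n i q)) ⟩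
    ρ^ ρ (i % q) x                          ≡⟨ ρ^-* ρ (i / q) (period _) ⟨
    ρ^ ρ (i / q * q) (ρ^ ρ (i % q) x)       ≡⟨ ρ^-+ ρ (i % q) _ x ⟨
    ρ^ ρ (i % q + i / q * q) x              ≡⟨ cong (λ k → ρ^ ρ k x) (m≡m%n+[m/n]*n i q) ⟨
    ρ^ ρ i x                                ∎
    where open ≡-Reasoning

  _∼?_ : ∀ x y → Dec (x ∼ y)
  x ∼? y = map′ (λ (i , e) → Fin.toℕ i , e) (λ (i , e) → i mod q , trans (reduce i x) e)
                (∃? (finite-Fin q) λ i → ρ^ ρ (Fin.toℕ i) x ≟ y)

  -- Both e and q are periods of x and they are coprime, so a Bézout identity makes 1 a period as
  -- well.
  fixed-by-shorter : ∀ {x e} → .{{NonZero e}} → e < q → ρ^ ρ e x ≡ x → ρ x ≡ x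
  fixed-by-shorter {x} {e} e<q ρᵉ with coprime-Bézout (prime⇒coprime q-prime e<q)
  ... | Bézout.+- a b eq = begin
        ρ x                  ≡⟨ cong ρ (ρ^-* ρ b ρᵉ) ⟨
        ρ (ρ^ ρ (b * e) x)   ≡⟨ ρ^-+ ρ (b * e) 1 x ⟨
        ρ^ ρ (b * e + 1) x   ≡⟨ cong (λ k → ρ^ ρ k x) (trans (+-comm (b * e) 1) eq) ⟩
        ρ^ ρ (a * q) x       ≡⟨ ρ^-* ρ a (period x) ⟩
        x                    ∎
        where open ≡-Reasoning
  ... | Bézout.-+ a b eq = begin
        ρ x                  ≡⟨ cong ρ (ρ^-* ρ a (period x)) ⟨
        ρ (ρ^ ρ (a * q) x)   ≡⟨ ρ^-+ ρ (a * q) 1 x ⟨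
        ρ^ ρ (a * q + 1) x   ≡⟨ cong (λ k → ρ^ ρ k x) (trans (+-comm (a * q) 1) eq) ⟩
        ρ^ ρ (b * e) x       ≡⟨ ρ^-* ρ b ρᵉ ⟩
        x                    ∎
        where open ≡-Reasoning

  -- Going on for q - i steps from the coincidence completes a period on one side and leaves j - i
  -- extra steps on the other, so j - i < q is a period of x.
  no-early-return : ∀ {x i j} → i < j → j < q → ρ^ ρ i x ≡ ρ^ ρ j x → ρ x ≡ x
  no-early-return {x} {i} {j} i<j j<q e =
    fixed-by-shorter {{ℕ.>-nonZero (m<n⇒0<n∸m i<j)}} (≤-<-trans (m∸n≤m j i) j<q) (begin
      ρ^ ρ (j ∸ i) x                          ≡⟨ cong (ρ^ ρ (j ∸ i)) (period x) ⟨
      ρ^ ρ (j ∸ i) (ρ^ ρ q x)                 ≡⟨ ρ^-+ ρ q (j ∸ i) x ⟨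
      ρ^ ρ (q + (j ∸ i)) x                    ≡⟨ cong (λ k → ρ^ ρ k x) exponents ⟩
      ρ^ ρ (j + (q ∸ i)) x                    ≡⟨ ρ^-+ ρ j (q ∸ i) x ⟩
      ρ^ ρ (q ∸ i) (ρ^ ρ j x)                 ≡⟨ cong (ρ^ ρ (q ∸ i)) e ⟨
      ρ^ ρ (q ∸ i) (ρ^ ρ i x)                 ≡⟨ ρ^-+ ρ i (q ∸ i) x ⟨
      ρ^ ρ (i + (q ∸ i)) x                    ≡⟨ cong (λ k → ρ^ ρ k x) (m+[n∸m]≡n i≤q) ⟩
      ρ^ ρ q x                                ≡⟨ period x ⟩
      x                                       ∎)
    where
    open ≡-Reasoning
    i≤q = ≤-trans (<⇒≤ i<j) (<⇒≤ j<q)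
    exponents : q + (j ∸ i) ≡ j + (q ∸ i)
    exponents = begin
      q + (j ∸ i) ≡⟨ +-∸-assoc q (<⇒≤ i<j) ⟨
      q + j ∸ i   ≡⟨ cong (_∸ i) (+-comm q j) ⟩
      j + q ∸ i   ≡⟨ +-∸-assoc j i≤q ⟩
      j + (q ∸ i) ∎

  orbit-size : ∀ {x} → ρ x ≢ x → count F (x ∼?_) ≡ q
  orbit-size {x} moved = begin
    count F (x ∼?_)             ≡⟨ *-identityʳ _ ⟨
    count F (x ∼?_) * 1         ≡⟨ double-count F (finite-Fin q) (x ∼?_) U? R? rows columns ⟩
    count (finite-Fin q) U? * 1 ≡⟨ *-identityʳ _ ⟩
    count (finite-Fin q) U?     ≡⟨ count-U-Fin q ⟩
    q                           ∎
    where
    open ≡-Reasoning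
    R? = λ y (i : Fin q) → ρ^ ρ (Fin.toℕ i) x ≟ y

    injective : ∀ i j → ρ^ ρ (Fin.toℕ i) x ≡ ρ^ ρ (Fin.toℕ j) x → i ≡ j
    injective i j e with <-cmp (Fin.toℕ i) (Fin.toℕ j)
    ... | tri< i<j _ _ = contradiction (no-early-return i<j (Fin.toℕ<n j) e) moved
    ... | tri≈ _ i≡j _ = Fin.toℕ-injective i≡j
    ... | tri> _ _ j<i = contradiction (no-early-return j<i (Fin.toℕ<n i) (sym e)) moved

    rows : ∀ y → x ∼ y → count (finite-Fin q) (U? ∩? R? y) ≡ 1
    rows y (i , e) = count-unique (finite-Fin q) (U? ∩? R? y) {i mod q} (tt , trans (reduce i x) e)
      λ { {j} (_ , e′) → injective j (i mod q) (trans e′ (sym (trans (reduce i x) e))) }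

    columns : ∀ i → U i → count F ((x ∼?_) ∩? (λ y → R? y i)) ≡ 1
    columns i _ = count-unique F ((x ∼?_) ∩? (λ y → R? y i)) ((Fin.toℕ i , refl) , refl) (sym ∘ proj₂)

  moved-divisible : {S : Pred X 0ℓ} (S? : Decidable S) → (∀ {x} → S x → S (ρ x)) →
                    q ∣ count F (S? ∩? ∁? (λ x → ρ x ≟ x))
  moved-divisible {S} S? S-ρ = classes-divide F ∼-equiv _∼?_ (S? ∩? ∁? (λ x → ρ x ≟ x))
    (λ { (i , refl) (s , moved) → iterated i s , moved ∘ fixed i })
    (orbit-size ∘ proj₂)
    where
    open ≡-Reasoning
    iterated : ∀ i {x} → S x → S (ρ^ ρ i x)
    iterated zero    s = s
    iterated (suc i) s = iterated i (S-ρ s)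

    fixed : ∀ i {x} → ρ (ρ^ ρ i x) ≡ ρ^ ρ i x → ρ x ≡ x
    fixed i {x} e with IsEquivalence.sym ∼-equiv {x} (i , refl)
    ... | j , back = begin
      ρ x                      ≡⟨ cong ρ back ⟨
      ρ (ρ^ ρ j (ρ^ ρ i x))    ≡⟨ ρ^-+ ρ j 1 _ ⟨
      ρ^ ρ (j + 1) (ρ^ ρ i x)  ≡⟨ cong (λ k → ρ^ ρ k (ρ^ ρ i x)) (+-comm j 1) ⟩
      ρ^ ρ j (ρ (ρ^ ρ i x))    ≡⟨ cong (ρ^ ρ j) e ⟩
      ρ^ ρ j (ρ^ ρ i x)        ≡⟨ back ⟩
      x                        ∎

rotate : {A : Set} {k : ℕ} → Vec A k → Vec A k
rotate []      = []
rotate (a ∷ v) = v ∷ʳ a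

module _ {A : Set} where

  -- The induction needs the tuple in the form `as ++ bs` with `as` moving step by step behind `bs`.
  -- On vectors this would shift the length index at each step, hence the detour through lists.
  rotate-period : ∀ {k} (v : Vec A k) → ρ^ rotate k v ≡ v
  rotate-period {k} v = begin
    ρ^ rotate k v                 ≡⟨ Vec.cast-is-id refl _ ⟨
    Vec.cast refl (ρ^ rotate k v) ≡⟨ Vec.toList-injective refl _ v (trans (toList-ρ^ k v)
      (subst (λ l → ρ^ rotateˡ l (Vec.toList v) ≡ Vec.toList v) (Vec.length-toList v) (full-turn (Vec.toList v)))) ⟩
    v                             ∎
    where
    open ≡-Reasoning

    rotateˡ : List A → List A
    rotateˡ []       = []
    rotateˡ (a ∷ as) = as ++ List.[ a ]

    toList-rotate : ∀ {k} (v : Vec A k) → Vec.toList (rotate v) ≡ rotateˡ (Vec.toList v)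
    toList-rotate []      = refl
    toList-rotate (a ∷ v) = Vec.toList-∷ʳ a v

    toList-ρ^ : ∀ i {k} (v : Vec A k) → Vec.toList (ρ^ rotate i v) ≡ ρ^ rotateˡ i (Vec.toList v)
    toList-ρ^ zero    v = refl
    toList-ρ^ (suc i) v = trans (toList-ρ^ i (rotate v)) (cong (ρ^ rotateˡ i) (toList-rotate v))

    turn : ∀ as bs → ρ^ rotateˡ (List.length as) (as ++ bs) ≡ bs ++ as
    turn []       bs = sym (List.++-identityʳ bs)
    turn (a ∷ as) bs = begin
      ρ^ rotateˡ (List.length as) ((as ++ bs) ++ List.[ a ])
        ≡⟨ cong (ρ^ rotateˡ (List.length as)) (List.++-assoc as bs _) ⟩
      ρ^ rotateˡ (List.length as) (as ++ (bs ++ List.[ a ]))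
        ≡⟨ turn as _ ⟩
      (bs ++ List.[ a ]) ++ as
        ≡⟨ List.++-assoc bs _ as ⟩
      bs ++ (a ∷ as) ∎

    full-turn : ∀ as → ρ^ rotateˡ (List.length as) as ≡ as
    full-turn as = trans (cong (ρ^ rotateˡ (List.length as)) (sym (List.++-identityʳ as))) (turn as [])

  rotate-fixed : ∀ {k} {v : Vec A (suc k)} → rotate v ≡ v → v ≡ Vec.replicate (suc k) (Vec.head v)
  rotate-fixed {v = a ∷ v} = cong (a ∷_) ∘ constant v
    where
    constant : ∀ {k} {a} (v : Vec A k) → v ∷ʳ a ≡ a ∷ v → v ≡ Vec.replicate k a
    constant []      _ = refl
    constant (b ∷ v) e with refl ← Vec.∷-injectiveˡ e = cong (b ∷_) (constant v (Vec.∷-injectiveʳ e))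

-- Finite groups

module FiniteGroup {A : Set} (F : Finite A) {_∙_ : Op₂ A} {ε : A} {_⁻¹ : Op₁ A}
                   (isGroup : IsGroup _≡_ _∙_ ε _⁻¹) where
  open Finite F using (_≟_)

  group : Group 0ℓ 0ℓ
  group = record { isGroup = isGroup }

  commutativeMonoid : Commutative _≡_ _∙_ → CommutativeMonoid 0ℓ 0ℓ
  commutativeMonoid comm = record { isCommutativeMonoid = record { isMonoid = IsGroup.isMonoid isGroup ; comm = comm } }

  open IsGroup isGroup using (assoc; identityˡ; identityʳ; inverseˡ; inverseʳ)
  open Algebra.Properties.Group group
  open Algebra.Properties.Monoid.Mult (Group.monoid group) renaming (_×_ to _times_)

  record IsSubgroup (P : Pred A 0ℓ) : Set where
    field
      member?   : Decidable P
      ε-closed  : P ε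
      ∙-closed  : ∀ {x y} → P x → P y → P (x ∙ y)
      ⁻¹-closed : ∀ {x} → P x → P (x ⁻¹)

  open IsSubgroup

  order : {P : Pred A 0ℓ} → IsSubgroup P → ℕ
  order P≤ = count F (member? P≤)

  times-ε : ∀ n → n times ε ≡ ε
  times-ε zero    = refl
  times-ε (suc n) = trans (identityˡ _) (times-ε n)

  times-multiple : ∀ a b {x} → b times x ≡ ε → (a * b) times x ≡ ε
  times-multiple a b {x} e = trans (sym (×-assocˡ x a b)) (trans (cong (a times_) e) (times-ε a))

  -- A Bézout identity over ℕ provides two consecutive exponents that both annihilate x.
  consecutive : ∀ k {x} → k times x ≡ ε → suc k times x ≡ ε → x ≡ ε
  consecutive k {x} e e′ = trans (sym (identityʳ x)) (trans (cong (x ∙_) (sym e)) e′)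

  coprime-orders : ∀ {m n x} → Coprime m n → m times x ≡ ε → n times x ≡ ε → x ≡ ε
  coprime-orders {m} {n} {x} coprime mx nx with coprime-Bézout coprime
  ... | Bézout.+- a b eq = consecutive (b * n) (times-multiple b n nx)
                             (trans (cong (_times x) eq) (times-multiple a m mx))
  ... | Bézout.-+ a b eq = consecutive (a * m) (times-multiple a m mx)
                             (trans (cong (_times x) eq) (times-multiple b n nx))

  -- Cauchy's theorem

  prod : ∀ {k} → Vec A k → A
  prod = Vec.foldr′ _∙_ ε

  prod-∷ʳ : ∀ {k} (v : Vec A k) a → prod (v ∷ʳ a) ≡ prod v ∙ a
  prod-∷ʳ []      a = trans (identityʳ a) (sym (identityˡ a))
  prod-∷ʳ (b ∷ v) a = trans (cong (b ∙_) (prod-∷ʳ v a)) (sym (assoc b _ a))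

  prod-replicate : ∀ k a → prod (Vec.replicate k a) ≡ k times a
  prod-replicate zero    a = refl
  prod-replicate (suc k) a = cong (a ∙_) (prod-replicate k a)

  -- McKay: rotation acts on the q-tuples with product ε, and fixes only the constant ones.
  cauchy : {P : Pred A 0ℓ} (P≤ : IsSubgroup P) {q : ℕ} → Prime q → q ∣ order P≤ →
           ∃[ x ] (P x × x ≢ ε × q times x ≡ ε)
  cauchy {P} P≤ {0}           ()
  cauchy {P} P≤ {1}           ()
  cauchy {P} P≤ {suc (suc k)} q-prime q∣P with ∃? F (λ x → member? P≤ x ×-dec ¬? (x ≟ ε) ×-dec (suc (suc k) times x ≟ ε))
  ... | yes found = found
  -- Without such an element the constant tuple of `ε` is the only fixed one, and q would divide 1.
  ... | no  none  = contradiction (∣1⇒≡1 (subst (q ∣_) count-fixed q∣fixed)) λ ()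
    where
    q = suc (suc k)
    Tuples = finite-Vec F q
    module Tuples = Finite Tuples

    All? : ∀ {n} → Decidable (All P {n})
    All? = All.all? (member? P≤)

    Relator : Pred (Vec A q) 0ℓ
    Relator v = All P v × prod v ≡ ε

    Relator? : Decidable Relator
    Relator? v = All? v ×-dec (prod v ≟ ε)

    prod∈P : ∀ {n} {v : Vec A n} → All P v → P (prod v)
    prod∈P []       = ε-closed P≤
    prod∈P (a ∷ as) = ∙-closed P≤ a (prod∈P as)

    All-∷ʳ : ∀ {n a} {v : Vec A n} → All P v → P a → All P (v ∷ʳ a)
    All-∷ʳ []       Pa = Pa ∷ []
    All-∷ʳ (b ∷ bs) Pa = b ∷ All-∷ʳ bs Pa

    Relator-rotate : ∀ {v} → Relator v → Relator (rotate v)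
    Relator-rotate {a ∷ v} (Pa ∷ Pv , av≡ε) = All-∷ʳ Pv Pa , (begin
      prod (v ∷ʳ a)   ≡⟨ prod-∷ʳ v a ⟩
      prod v ∙ a      ≡⟨ cong (_∙ a) (inverseʳ-unique a (prod v) av≡ε) ⟩
      (a ⁻¹) ∙ a      ≡⟨ inverseˡ a ⟩
      ε               ∎)
      where open ≡-Reasoning

    -- The first entry of a relator is the inverse of the product of the others, and these are
    -- arbitrary members of `P`.
    count-relators : count Tuples Relator? ≡ count (finite-Vec F (suc k)) All?
    count-relators = count-bijection Tuples (finite-Vec F (suc k)) Relator? All?
      Vec.tail (λ v → prod v ⁻¹ ∷ v)
      (λ { {_ ∷ _} (_ ∷ Pv , _) → Pv })
      (λ Pv → ⁻¹-closed P≤ (prod∈P Pv) ∷ Pv , inverseˡ _)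
      (λ { {a ∷ v} (_ , av≡ε) → cong (_∷ v) (sym (inverseˡ-unique a (prod v) av≡ε)) })
      (λ _ → refl)

    count-All : count (finite-Vec F (suc k)) All? ≡ order P≤ * count (finite-Vec F k) All?
    count-All = begin
      count (finite-Vec F (suc k)) All?
        ≡⟨ ∑-concatMap (elements F) _ (λ v → 𝟙 (All? v)) ⟩
      ∑ (elements F) (λ a → ∑ (List.map (a ∷_) vs) (λ v → 𝟙 (All? v)))
        ≡⟨ ∑-cong (elements F) (λ a → trans (∑-map vs (a ∷_) (λ v → 𝟙 (All? v))) (trans
             (∑-cong vs λ v → 𝟙-× (member? P≤ a) (All? v)) (∑-*ˡ vs (𝟙 (member? P≤ a)) _))) ⟩
      ∑ (elements F) (λ a → 𝟙 (member? P≤ a) * count (finite-Vec F k) All?)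
        ≡⟨ ∑-*ʳ (elements F) _ _ ⟩
      order P≤ * count (finite-Vec F k) All? ∎
      where
      open ≡-Reasoning
      open Finite using (elements)
      vs = elements (finite-Vec F k)

    q∣relators : q ∣ count Tuples Relator?
    q∣relators = subst (q ∣_) (sym (trans count-relators count-All)) (∣m⇒∣m*n _ q∣P)

    Fixed? : Decidable (λ v → rotate v ≡ v)
    Fixed? v = rotate v Tuples.≟ v

    q∣fixed : q ∣ count Tuples (Relator? ∩? Fixed?)
    q∣fixed = ∣m+n∣m⇒∣n
      (subst (q ∣_) (trans (count-split Tuples Relator? Fixed?)
                           (+-comm (count Tuples (Relator? ∩? Fixed?)) _)) q∣relators)
      (PrimePeriod.moved-divisible Tuples rotate q-prime rotate-period Relator? Relator-rotate)

    count-fixed : count Tuples (Relator? ∩? Fixed?) ≡ 1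
    count-fixed = count-unique Tuples (Relator? ∩? Fixed?) {Vec.replicate q ε}
      ((replicated q , trans (prod-replicate q ε) (times-ε q)) , rotate-replicate (suc k))
      λ { {v} ((Pv , v≡ε) , v-fixed) → trans (rotate-fixed v-fixed) (cong (Vec.replicate q) (only-ε v Pv v≡ε v-fixed)) }
      where
      replicated : ∀ n → All P (Vec.replicate n ε)
      replicated zero    = []
      replicated (suc n) = ε-closed P≤ ∷ replicated n

      rotate-replicate : ∀ n → Vec.replicate n ε ∷ʳ ε ≡ ε ∷ Vec.replicate n ε
      rotate-replicate zero    = refl
      rotate-replicate (suc n) = cong (ε ∷_) (rotate-replicate n)

      only-ε : ∀ v → All P v → prod v ≡ ε → rotate v ≡ v → Vec.head v ≡ ε
      only-ε v Pv@(Pa ∷ _) v≡ε v-fixed = decidable-stable (Vec.head v ≟ ε) λ a≢ε → none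
        (Vec.head v , Pa , a≢ε ,
          trans (sym (prod-replicate q (Vec.head v))) (trans (cong prod (sym (rotate-fixed v-fixed))) v≡ε))

  -- Automorphisms and conjugation

  record Automorphism : Set where
    field
      to from : A → A
      from-to : ∀ x → from (to x) ≡ x
      to-from : ∀ x → to (from x) ≡ x
      homo    : ∀ x y → to (x ∙ y) ≡ to x ∙ to y

    to-ε : to ε ≡ ε
    to-ε = identityˡ-unique (to ε) (to ε) (trans (sym (homo ε ε)) (cong to (identityˡ ε)))

    to-⁻¹ : ∀ x → to (x ⁻¹) ≡ to x ⁻¹
    to-⁻¹ x = inverseʳ-unique (to x) (to (x ⁻¹))
      (trans (sym (homo x (x ⁻¹))) (trans (cong to (inverseʳ x)) to-ε))

    to-times : ∀ n x → to (n times x) ≡ n times to x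
    to-times zero    x = to-ε
    to-times (suc n) x = trans (homo x _) (cong (to x ∙_) (to-times n x))

  open Automorphism

  -- As `g` is a bijection, the two implications together mean g(P) = Q.
  Maps : Automorphism → Rel (Pred A 0ℓ) 0ℓ
  Maps g P Q = (∀ {x} → P x → Q (to g x)) × (∀ {x} → Q (to g x) → P x)

  conjugate : A → A → A
  conjugate a x = (a ∙ x) ∙ (a ⁻¹)

  conjugate-∙ˡ : ∀ a b x → conjugate (a ∙ b) x ≡ conjugate a (conjugate b x)
  conjugate-∙ˡ a b x = begin
    ((a ∙ b) ∙ x) ∙ ((a ∙ b) ⁻¹)         ≡⟨ cong₂ _∙_ (assoc a b x) (⁻¹-anti-homo-∙ a b) ⟩
    (a ∙ (b ∙ x)) ∙ ((b ⁻¹) ∙ (a ⁻¹))    ≡⟨ assoc _ _ _ ⟨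
    ((a ∙ (b ∙ x)) ∙ (b ⁻¹)) ∙ (a ⁻¹)    ≡⟨ cong (_∙ (a ⁻¹)) (assoc a (b ∙ x) _) ⟩
    (a ∙ ((b ∙ x) ∙ (b ⁻¹))) ∙ (a ⁻¹)    ∎
    where open ≡-Reasoning

  conjugate-ε : ∀ x → conjugate ε x ≡ x
  conjugate-ε x = trans (cong₂ _∙_ (identityˡ x) ε⁻¹≈ε) (identityʳ x)

  conjugation : A → Automorphism
  conjugation a = record
    { to      = conjugate a
    ; from    = conjugate (a ⁻¹)
    ; from-to = λ x → trans (sym (conjugate-∙ˡ (a ⁻¹) a x))
                            (trans (cong (λ b → conjugate b x) (inverseˡ a)) (conjugate-ε x))
    ; to-from = λ x → trans (sym (conjugate-∙ˡ a (a ⁻¹) x))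
                            (trans (cong (λ b → conjugate b x) (inverseʳ a)) (conjugate-ε x))
    ; homo    = λ x y → begin
        (a ∙ (x ∙ y)) ∙ (a ⁻¹)                      ≡⟨ cong (_∙ (a ⁻¹)) (assoc a x y) ⟨
        ((a ∙ x) ∙ y) ∙ (a ⁻¹)                      ≡⟨ assoc (a ∙ x) y (a ⁻¹) ⟩
        (a ∙ x) ∙ (y ∙ (a ⁻¹))                      ≡⟨ cong ((a ∙ x) ∙_) (\\-leftDividesʳ a _) ⟨
        (a ∙ x) ∙ ((a ⁻¹) ∙ (a ∙ (y ∙ (a ⁻¹))))     ≡⟨ assoc (a ∙ x) (a ⁻¹) _ ⟨
        ((a ∙ x) ∙ (a ⁻¹)) ∙ (a ∙ (y ∙ (a ⁻¹)))     ≡⟨ cong (conjugate a x ∙_) (assoc a y (a ⁻¹)) ⟨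
        conjugate a x ∙ conjugate a y               ∎
    }
    where open ≡-Reasoning

  to-conjugate : ∀ g a x → to g (conjugate a x) ≡ conjugate (to g a) (to g x)
  to-conjugate g a x = trans (homo g _ _) (cong₂ _∙_ (homo g a x) (to-⁻¹ g a))

  whole : IsSubgroup U
  whole = record { member? = U? ; ε-closed = tt ; ∙-closed = λ _ _ → tt ; ⁻¹-closed = λ _ → tt }

  -- Left cosets and the conjugation action on them

  module Cosets {P : Pred A 0ℓ} (P≤ : IsSubgroup P) where

    _≈_ : Rel A 0ℓ
    x ≈ y = P ((x ⁻¹) ∙ y)

    _≈?_ : ∀ x y → Dec (x ≈ y)
    x ≈? y = member? P≤ ((x ⁻¹) ∙ y)

    ≈-equiv : IsEquivalence _≈_
    ≈-equiv = record
      { refl  = λ {x} → subst P (sym (inverseˡ x)) (ε-closed P≤)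
      ; sym   = λ {x} {y} x≈y → subst P (⁻¹-anti-homo-\\ x y) (⁻¹-closed P≤ x≈y)
      ; trans = λ {x} {y} {z} x≈y y≈z → subst P
          (trans (assoc (x ⁻¹) y _) (cong ((x ⁻¹) ∙_) (\\-leftDividesˡ y z))) (∙-closed P≤ x≈y y≈z)
      }

    ≈-resp : ∀ {x y} → x ≈ y → P x → P y
    ≈-resp {x} {y} x≈y Px = subst P (\\-leftDividesˡ x y) (∙-closed P≤ Px x≈y)

    members-≈ : ∀ {x y} → P x → P y → x ≈ y
    members-≈ Px Py = ∙-closed P≤ (⁻¹-closed P≤ Px) Py

    ≈-map : ∀ g → (∀ {x} → P x → P (to g x)) → ∀ {x y} → x ≈ y → to g x ≈ to g y
    ≈-map g P⇒P {x} {y} x≈y = subst P (trans (homo g _ _) (cong (_∙ to g y) (to-⁻¹ g x))) (P⇒P x≈y)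

    ≈-map⁻ : ∀ g → (∀ {x} → P (to g x) → P x) → ∀ {x y} → to g x ≈ to g y → x ≈ y
    ≈-map⁻ g P⇒P {x} {y} e = P⇒P (subst P (sym (trans (homo g _ _) (cong (_∙ to g y) (to-⁻¹ g x)))) e)

    coset-size : ∀ x → count F (x ≈?_) ≡ order P≤
    coset-size x = count-bijection F F (x ≈?_) (member? P≤) ((x ⁻¹) ∙_) (x ∙_) id
      (λ {y} → subst P (sym (\\-leftDividesʳ x y)))
      (λ {y} _ → \\-leftDividesˡ x y) (λ {y} _ → \\-leftDividesʳ x y)

    -- Stated for unions of left cosets, since it has to serve for the orbits of conjugation as well
    -- as for the whole group.
    lagrange : {S : Pred A 0ℓ} (S? : Decidable S) → (∀ {x y} → x ≈ y → S x → S y) →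
               order P≤ ∣ count F S?
    lagrange S? closed = classes-divide F ≈-equiv _≈?_ S? closed (λ {x} _ → coset-size x)

    outside? : Decidable (∁ P)
    outside? = ∁? (member? P≤)

    order-outside : order whole ≡ order P≤ + count F outside?
    order-outside = trans (count-split F (member? whole) (member? P≤)) (cong₂ _+_
      (count-cong F (member? whole ∩? member? P≤) (member? P≤) proj₂ (tt ,_))
      (count-cong F (member? whole ∩? outside?) outside? proj₂ (tt ,_)))

    order-proper : ∀ {x} → ¬ P x → order P≤ < order whole
    order-proper x∉P = subst (order P≤ <_) (sym order-outside)
      (m<m+n (order P≤) (count-positive F outside? x∉P))

    order>0 : 0 < order P≤
    order>0 = count-positive F (member? P≤) (ε-closed P≤)

    instance
      order≢0 : NonZero (order P≤)
      order≢0 = ℕ.>-nonZero order>0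

  -- Conjugation by L on the left cosets of P fixes P. The other orbits have a common size s, which divides both |L|
  -- and [A : P] − 1; when |L| and [A : P] are powers of one prime, s = 1.
  module ConjugationOnCosets
    {P L : Pred A 0ℓ} (P≤ : IsSubgroup P) (L≤ : IsSubgroup L)
    (normalises : ∀ {a x} → L a → P x → P (conjugate a x))
    (transitive : ∀ {x y} → ¬ P x → ¬ P y → ∃[ g ] (Maps g P P × Maps g L L × P ((y ⁻¹) ∙ to g x)))
    {x₀ : A} (x₀∉P : ¬ P x₀) {u : ℕ} (A≡P*u : order whole ≡ order P≤ * u)
    -- This replaces the assumption that |L| and the index u are powers of one prime.
    (primes-agree : ∀ {q q′} → Prime q → Prime q′ → q ∣ order L≤ → q′ ∣ u → q ≡ q′)
    where
    open Cosets P≤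
    private
      module ≈ = IsEquivalence ≈-equiv
      m = order P≤

    conjugate-≈ : ∀ {a x y} → L a → x ≈ y → conjugate a x ≈ conjugate a y
    conjugate-≈ {a} La = ≈-map (conjugation a) (normalises La)

    -- The class of x is the union of the cosets in the L-orbit of xP, so it has s · m elements if
    -- that orbit has s cosets.
    _∼_ : Rel A 0ℓ
    x ∼ y = ∃[ a ] (L a × conjugate a x ≈ y)

    _∼?_ : ∀ x y → Dec (x ∼ y)
    x ∼? y = ∃? F (λ a → member? L≤ a ×-dec (conjugate a x ≈? y))

    ≡⇒≈ : ∀ {x y} → x ≡ y → x ≈ y
    ≡⇒≈ refl = ≈.refl

    ∼-equiv : IsEquivalence _∼_
    ∼-equiv = record
      { refl  = λ {x} → ε , ε-closed L≤ , ≡⇒≈ (conjugate-ε x)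
      ; sym   = λ { {x} (a , La , ax≈y) → a ⁻¹ , ⁻¹-closed L≤ La ,
                  ≈.trans (conjugate-≈ (⁻¹-closed L≤ La) (≈.sym ax≈y)) (≡⇒≈ (from-to (conjugation a) x)) }
      ; trans = λ { {x} (a , La , ax≈y) (b , Lb , by≈z) → b ∙ a , ∙-closed L≤ Lb La ,
                  ≈.trans (≡⇒≈ (conjugate-∙ˡ b a x)) (≈.trans (conjugate-≈ Lb ax≈y) by≈z) }
      }

    stabiliser? : ∀ x → Decidable (λ a → L a × conjugate a x ≈ x)
    stabiliser? x = member? L≤ ∩? (λ a → conjugate a x ≈? x)

    -- Counts the pairs (a, y) with a in L and axa⁻¹ in the coset yP: each a admits the m elements
    -- of one coset, and each y admits a left translate of the stabiliser of xP.
    orbit-stabiliser : ∀ x → order L≤ * m ≡ count F (x ∼?_) * count F (stabiliser? x)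
    orbit-stabiliser x = double-count F F (member? L≤) (x ∼?_) (λ a y → conjugate a x ≈? y) rows columns
      where
      rows : ∀ a → L a → count F ((x ∼?_) ∩? (conjugate a x ≈?_)) ≡ m
      rows a La = trans (count-cong F ((x ∼?_) ∩? (conjugate a x ≈?_)) (conjugate a x ≈?_)
                          proj₂ (λ ax≈y → (a , La , ax≈y) , ax≈y))
                        (coset-size _)

      columns : ∀ y → x ∼ y → count F (member? L≤ ∩? (λ a → conjugate a x ≈? y)) ≡ count F (stabiliser? x)
      columns y (a , La , ax≈y) = count-bijection F F (member? L≤ ∩? (λ a → conjugate a x ≈? y)) (stabiliser? x)
        ((a ⁻¹) ∙_) (a ∙_)
        (λ { {b} (Lb , bx≈y) → ∙-closed L≤ La⁻¹ Lb ,
             ≈.trans (≡⇒≈ (conjugate-∙ˡ (a ⁻¹) b x))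
               (≈.trans (conjugate-≈ La⁻¹ (≈.trans bx≈y (≈.sym ax≈y))) (≡⇒≈ (from-to (conjugation a) x))) })
        (λ { {b} (Lb , bx≈x) → ∙-closed L≤ La Lb ,
             ≈.trans (≡⇒≈ (conjugate-∙ˡ a b x)) (≈.trans (conjugate-≈ La bx≈x) ax≈y) })
        (λ {b} _ → \\-leftDividesˡ a b) (λ {b} _ → \\-leftDividesʳ a b)
        where La⁻¹ = ⁻¹-closed L≤ La

    -- An automorphism that preserves P and L and takes xP to yP carries one stabiliser onto the
    -- other. This is how transitivity on cosets forces equal orbit lengths.
    stabilisers-agree : ∀ {x y} → ¬ P x → ¬ P y → count F (stabiliser? x) ≡ count F (stabiliser? y)
    stabilisers-agree {x} {y} x∉P y∉P with transitive x∉P y∉P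
    ... | g , (P⇒ , P⇐) , (L⇒ , L⇐) , y≈gx = count-bijection F F (stabiliser? x) (stabiliser? y) (to g) (from g)
      (λ { {a} (La , ax≈x) → L⇒ La , forward a (L⇒ La) ax≈x })
      (λ { {b} (Lb , by≈y) → L⇐ (subst L (sym (to-from g b)) Lb) ,
           backward (from g b) (subst L (sym (to-from g b)) Lb)
             (subst (λ c → conjugate c y ≈ y) (sym (to-from g b)) by≈y) })
      (λ {a} _ → from-to g a) (λ {b} _ → to-from g b)
      where
      forward : ∀ a → L (to g a) → conjugate a x ≈ x → conjugate (to g a) y ≈ y
      forward a Lga ax≈x = ≈.trans (conjugate-≈ Lga y≈gx) (≈.trans (≡⇒≈ (sym (to-conjugate g a x)))
        (≈.trans (≈-map g P⇒ ax≈x) (≈.sym y≈gx)))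

      backward : ∀ a → L (to g a) → conjugate (to g a) y ≈ y → conjugate a x ≈ x
      backward a Lga e = ≈-map⁻ g P⇐ (≈.trans (≡⇒≈ (to-conjugate g a x))
        (≈.trans (conjugate-≈ Lga (≈.sym y≈gx)) (≈.trans e y≈gx)))

    c k : ℕ
    c = count F (x₀ ∼?_)
    k = count F (stabiliser? x₀)

    instance
      k≢0 : NonZero k
      k≢0 = ℕ.>-nonZero (count-positive F (stabiliser? x₀) {ε} (ε-closed L≤ , ≡⇒≈ (conjugate-ε x₀)))

    orbits-agree : ∀ {x} → ¬ P x → count F (x ∼?_) ≡ c
    orbits-agree {x} x∉P = *-cancelʳ-≡ _ _ k (trans (cong (count F (x ∼?_) *_) (stabilisers-agree x₀∉P x∉P))
      (trans (sym (orbit-stabiliser x)) (orbit-stabiliser x₀)))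

    outside-closed : ∀ {x y} → x ∼ y → ¬ P x → ¬ P y
    outside-closed {x} (a , La , ax≈y) x∉P Py = x∉P (subst P (from-to (conjugation a) x)
      (normalises (⁻¹-closed L≤ La) (≈-resp (≈.sym ax≈y) Py)))

    m∣c : m ∣ c
    m∣c = lagrange (x₀ ∼?_) λ { x≈y (a , La , ax₀≈x) → a , La , ≈.trans ax₀≈x x≈y }

    c∣outside : c ∣ count F outside?
    c∣outside = classes-divide F ∼-equiv _∼?_ outside? outside-closed orbits-agree

    trivial-orbits : order L≤ ≡ k
    trivial-orbits with divides s c≡s*m ← m∣c | divides t out≡t*c ← c∣outside
      = case s ℕ.≟ 1 of λ
      { (yes s≡1) → trans L≡s*k (trans (cong (_* k) s≡1) (*-identityˡ k))
      ; (no s≢1)  → ⊥-elim (absurd s≢1)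
      }
      where
      L≡s*k : order L≤ ≡ s * k
      L≡s*k = *-cancelʳ-≡ _ _ m (begin
        order L≤ * m ≡⟨ orbit-stabiliser x₀ ⟩
        c * k        ≡⟨ cong (_* k) c≡s*m ⟩
        s * m * k    ≡⟨ *-assoc s m k ⟩
        s * (m * k)  ≡⟨ cong (s *_) (*-comm m k) ⟩
        s * (k * m)  ≡⟨ *-assoc s k m ⟨
        s * k * m    ∎)
        where open ≡-Reasoning

      u≡1+t*s : u ≡ 1 + t * s
      u≡1+t*s = *-cancelˡ-≡ _ _ m (begin
        m * u               ≡⟨ A≡P*u ⟨
        order whole         ≡⟨ order-outside ⟩
        m + count F outside? ≡⟨ cong (m +_) (trans out≡t*c (cong (t *_) c≡s*m)) ⟩
        m + t * (s * m)     ≡⟨ cong (m +_) (trans (sym (*-assoc t s m)) (*-comm (t * s) m)) ⟩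
        m + m * (t * s)     ≡⟨ *-suc m (t * s) ⟨
        m * (1 + t * s)     ∎)
        where open ≡-Reasoning

      u≢1 : u ≢ 1
      u≢1 refl = <-irrefl (sym (trans A≡P*u (*-identityʳ m))) (order-proper x₀∉P)

      -- A prime of s divides |L|, so it coincides with a prime of u; dividing both u = 1 + t · s
      -- and t · s, it divides 1.
      absurd : s ≢ 1 → ⊥
      absurd s≢1 with q , q-prime , q∣s ← prime-divisor s s≢1 | q′ , q′-prime , q′∣u ← prime-divisor u u≢1
        with refl ← primes-agree q-prime q′-prime (subst (q ∣_) (sym L≡s*k) (∣m⇒∣m*n k q∣s)) q′∣u
        = ¬prime[1] (subst Prime (∣1⇒≡1 q∣1) q-prime)
        where
        q∣1 : q ∣ 1
        q∣1 = ∣m+n∣m⇒∣n (subst (q ∣_) (trans u≡1+t*s (+-comm 1 (t * s))) q′∣u) (∣n⇒∣m*n t q∣s)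

    -- The coset P itself is fixed because L normalises P. Outside P every stabiliser has the order
    -- of L, which leaves a count of 0 for the elements that move the coset.
    conjugate-trivial : ∀ {a} → L a → ∀ x → conjugate a x ≈ x
    conjugate-trivial {a} La x with member? P≤ x
    ... | yes Px  = members-≈ (normalises La Px) Px
    ... | no  x∉P = decidable-stable (conjugate a x ≈? x) λ ax≉x →
      n≮n 0 (subst (0 <_) moved≡0 (count-positive F moved? {a} (La , ax≉x)))
      where
      moved? : Decidable (λ a → L a × ¬ (conjugate a x ≈ x))
      moved? = member? L≤ ∩? ∁? (λ a → conjugate a x ≈? x)

      moved≡0 : count F moved? ≡ 0
      moved≡0 = +-cancelˡ-≡ (count F (stabiliser? x)) _ _ (begin
        count F (stabiliser? x) + count F moved? ≡⟨ count-split F (member? L≤) (λ a → conjugate a x ≈? x) ⟨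
        order L≤                                 ≡⟨ trivial-orbits ⟩
        k                                        ≡⟨ stabilisers-agree x₀∉P x∉P ⟩
        count F (stabiliser? x)                  ≡⟨ +-identityʳ _ ⟨
        count F (stabiliser? x) + 0              ∎)
        where open ≡-Reasoning

  -- Groups factorised by a transitive family of subgroups

  module TransitiveFactorisation
    {I : Set} (P : I → Pred A 0ℓ) (P≤ : ∀ i → IsSubgroup (P i))
    (factor : ∀ {i j} → i ≢ j → ∀ x → ∃[ a ] (P i a × P j ((a ⁻¹) ∙ x)))
    (proper : ∀ i → ∃[ x ] ¬ P i x)
    (i₀ : I) (other : ∀ (i : I) → ∃[ j ] i ≢ j)
    (index-transitive : ∀ i j → ∃[ g ] Maps g (P i) (P j))
    (coset-transitive : ∀ {i x y} → ¬ P i x → ¬ P i y →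
                        ∃[ g ] (Maps g (P i) (P i) × P i ((y ⁻¹) ∙ Automorphism.to g x)))
    (element-transitive : ∀ {i j x y} → P i x → x ≢ ε → P j y → y ≢ ε →
                          ∃[ g ] Automorphism.to g x ≡ y)
    where
    open Automorphism using (to; from; from-to; to-from; homo; to-ε; to-⁻¹; to-times)

    orders-agree : ∀ i j → order (P≤ i) ≡ order (P≤ j)
    orders-agree i j with g , P⇒ , P⇐ ← index-transitive i j =
      count-bijection F F (member? (P≤ i)) (member? (P≤ j)) (to g) (from g) P⇒
        (λ {b} Pb → P⇐ (subst (P j) (sym (to-from g b)) Pb))
        (λ {a} _ → from-to g a) (λ {b} _ → to-from g b)

    -- Any two factorisations of x over `P i` and `P j` differ by an element of the intersection, so
    -- every x has |P i ∩ P j| of them.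
    order-product : ∀ {i j} → i ≢ j →
                    order (P≤ i) * order (P≤ j) ≡
                    order whole * count F (λ x → member? (P≤ i) x ×-dec member? (P≤ j) x)
    order-product {i} {j} i≢j = double-count F F (member? (P≤ i)) (member? whole)
      (λ a x → member? (P≤ j) ((a ⁻¹) ∙ x)) rows columns
      where
      rows : ∀ a → P i a → count F (member? whole ∩? (λ x → member? (P≤ j) ((a ⁻¹) ∙ x))) ≡ order (P≤ j)
      rows a _ = trans (count-cong F (member? whole ∩? (λ x → member? (P≤ j) ((a ⁻¹) ∙ x))) (a ≈?_)
                         proj₂ (tt ,_))
                       (coset-size a)
        where open Cosets (P≤ j)

      columns : ∀ x → U x → count F (member? (P≤ i) ∩? (λ a → member? (P≤ j) ((a ⁻¹) ∙ x)))
                        ≡ count F (λ x → member? (P≤ i) x ×-dec member? (P≤ j) x)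
      columns x _ with a , Pa , a≈x ← factor i≢j x =
        count-bijection F F (member? (P≤ i) ∩? (λ b → member? (P≤ j) ((b ⁻¹) ∙ x)))
          (member? (P≤ i) ∩? member? (P≤ j)) ((a ⁻¹) ∙_) (a ∙_)
          (λ { {b} (Pb , b≈x) → ∙-closed (P≤ i) (⁻¹-closed (P≤ i) Pa) Pb , ≈.trans a≈x (≈.sym b≈x) })
          (λ { {b} (Pb , Qb) → ∙-closed (P≤ i) Pa Pb ,
               ≈.trans (≈.sym (subst (P j) (sym (\\-leftDividesʳ a b)) Qb)) a≈x })
          (λ {b} _ → \\-leftDividesˡ a b) (λ {b} _ → \\-leftDividesʳ a b)
        where
        open Cosets (P≤ j)
        module ≈ = IsEquivalence ≈-equiv

    -- With equal orders the product formula reads |P i|² = u · |P i| · μ, where μ is the order of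
    -- an intersection. Cancelling |P i| shows that the index divides |P i|, so its primes are
    -- primes of |P i|.
    index : ∀ i → ∃[ u ] (order whole ≡ order (P≤ i) * u × u ∣ order (P≤ i))
    index i with divides u A≡u*P ← Cosets.lagrange (P≤ i) (member? whole) (λ _ _ → tt)
               | j , i≢j ← other i
      = u , trans A≡u*P (*-comm u _) , divides μ (*-cancelʳ-≡ _ _ (order (P≤ i)) (begin
          order (P≤ i) * order (P≤ i)          ≡⟨ cong (order (P≤ i) *_) (orders-agree i j) ⟩
          order (P≤ i) * order (P≤ j)          ≡⟨ order-product i≢j ⟩
          order whole * μ          ≡⟨ cong (_* μ) A≡u*P ⟩
          u * order (P≤ i) * μ                 ≡⟨ *-comm _ μ ⟩
          μ * (u * order (P≤ i))               ≡⟨ *-assoc μ u _ ⟨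
          μ * u * order (P≤ i)                 ∎))
      where
      open ≡-Reasoning
      open Cosets (P≤ i) using (order≢0)
      μ = count F (λ x → member? (P≤ i) x ×-dec member? (P≤ j) x)

    -- By Cauchy, distinct prime divisors would give elements of coprime orders in one orbit.
    primes-agree : ∀ i {q q′} → Prime q → Prime q′ → q ∣ order (P≤ i) → q′ ∣ order (P≤ i) → q ≡ q′
    primes-agree i {q} {q′} q-prime q′-prime q∣P q′∣P
      with x , Px , x≢ε , qx≡ε ← cauchy (P≤ i) q-prime q∣P
         | y , Py , y≢ε , q′y≡ε ← cauchy (P≤ i) q′-prime q′∣P
      with g , gx≡y ← element-transitive Px x≢ε Py y≢ε
      = decidable-stable (q ℕ.≟ q′) λ q≢q′ → y≢ε (coprime-orders (prime-coprime q-prime q′-prime q≢q′)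
          (trans (cong (q times_) (sym gx≡y)) (trans (sym (to-times g q x)) (trans (cong (to g) qx≡ε) (to-ε g))))
          q′y≡ε)

    -- Common source of `normal` (L is `P i`) and `commutator∈P` (L is the whole group). L must be
    -- invariant under the automorphisms that fuse the cosets, and its order may have no new primes.
    commutes : ∀ {i} {L : Pred A 0ℓ} (L≤ : IsSubgroup L) → (∀ {a x} → L a → P i x → P i (conjugate a x)) →
               (∀ g → Maps g (P i) (P i) → Maps g L L) →
               (∀ {q} → Prime q → q ∣ order L≤ → q ∣ order (P≤ i)) →
               ∀ {a} → L a → ∀ x → P i ((x ⁻¹) ∙ conjugate a x)
    commutes {i} L≤ normalises L-invariant L∣ {a} La x = let u , A≡P*u , u∣P = index i in
      IsEquivalence.sym (Cosets.≈-equiv (P≤ i)) {conjugate a x} (ConjugationOnCosets.conjugate-trivial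
        (P≤ i) L≤ normalises
        (λ x∉P y∉P → let g , maps , gx≈y = coset-transitive x∉P y∉P in g , maps , L-invariant g maps , gx≈y)
        (proj₂ (proper i)) A≡P*u
        (λ q-prime q′-prime q∣L q′∣u → primes-agree i q-prime q′-prime (L∣ q-prime q∣L) (∣-trans q′∣u u∣P))
        La x)

    -- `P i` fixes each of its left cosets, in particular that of a⁻¹: hence a · (x a⁻¹ x⁻¹) lies in
    -- `P i`, and multiplying by x on the right leaves the conjugate axa⁻¹.
    normal : ∀ i {a x} → P i x → P i (conjugate a x)
    normal i {a} {x} Px = subst (P i) rearrange (∙-closed (P≤ i) commutes-P Px)
      where
      open ≡-Reasoning

      commutes-P : P i ((a ⁻¹ ⁻¹) ∙ conjugate x (a ⁻¹))
      commutes-P = commutes (P≤ i) (λ Pa Px → ∙-closed (P≤ i) (∙-closed (P≤ i) Pa Px) (⁻¹-closed (P≤ i) Pa))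
        (λ _ maps → maps) (λ _ → id) Px (a ⁻¹)

      rearrange : ((a ⁻¹ ⁻¹) ∙ conjugate x (a ⁻¹)) ∙ x ≡ conjugate a x
      rearrange = begin
        ((a ⁻¹ ⁻¹) ∙ ((x ∙ (a ⁻¹)) ∙ (x ⁻¹))) ∙ x   ≡⟨ assoc _ _ x ⟩
        (a ⁻¹ ⁻¹) ∙ (((x ∙ (a ⁻¹)) ∙ (x ⁻¹)) ∙ x)   ≡⟨ cong₂ _∙_ (⁻¹-involutive a) (//-rightDividesˡ x _) ⟩
        a ∙ (x ∙ (a ⁻¹))                            ≡⟨ assoc a x _ ⟨
        (a ∙ x) ∙ (a ⁻¹)                            ∎

    -- This is commutativity of the quotient by `P i`. Normality lets the whole group act on the
    -- cosets, and a prime dividing |P i| · u divides |P i|, because u does.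
    commutator∈P : ∀ i a x → P i ((x ⁻¹) ∙ conjugate a x)
    commutator∈P i a x = commutes whole (λ _ → normal i) (λ _ _ → (λ _ → tt) , (λ _ → tt))
      (λ {q} q-prime q∣A → let u , A≡P*u , u∣P = index i in
        [ id , (λ q∣u → ∣-trans q∣u u∣P) ]′ (euclidsLemma (order (P≤ i)) u q-prime (subst (q ∣_) A≡P*u q∣A)))
      tt x

    -- A nontrivial commutator would lie in every P i, as would its images; but these cover all the P i.
    commutative : ∀ a x → a ∙ x ≡ x ∙ a
    commutative a x = decidable-stable (a ∙ x ≟ x ∙ a) λ ax≢xa →
      let j , i≢j = other i₀
          y , y∉P = proper j
          b , Pb , b≈y = factor i≢j y
          z≢ε = λ z≡ε → ax≢xa (trans (sym (//-rightDividesˡ a (a ∙ x)))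
                  (cong (_∙ a) (trans (inverseʳ-unique (x ⁻¹) _ z≡ε) (⁻¹-involutive x))))
      -- If all the `P i` coincide, both factors of y lie in `P j`, although y was chosen outside
      -- it.
      in y∉P (Cosets.≈-resp (P≤ j) b≈y (all-equal z≢ε i₀ j Pb))
      where
      z = (x ⁻¹) ∙ conjugate a x
      all-equal : z ≢ ε → ∀ i j {y} → P i y → P j y
      all-equal z≢ε i j {y} Py with y ≟ ε
      ... | yes refl = ε-closed (P≤ j)
      ... | no  y≢ε =
        let g , gz≡y = element-transitive (commutator∈P i a x) z≢ε Py y≢ε
        in subst (P j) (trans (sym (trans (homo g _ _) (cong₂ _∙_ (to-⁻¹ g x) (to-conjugate g a x)))) gz≡y)
            (commutator∈P j (to g a) (to g x))

    -- A trivial `P i₀` would have index 1, since the index divides its order; but it is proper.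
    order≢1 : order (P≤ i₀) ≢ 1
    order≢1 P≡1 =
      let u , A≡P*u , u∣P = index i₀
          u≡1 = ∣1⇒≡1 (subst (u ∣_) P≡1 u∣P)
      in <-irrefl (sym (trans A≡P*u (trans (cong (order (P≤ i₀) *_) u≡1) (*-identityʳ _))))
           (Cosets.order-proper (P≤ i₀) (proj₂ (proper i₀)))

    open Algebra.Properties.CommutativeMonoid.Mult (commutativeMonoid commutative) using (×-distrib-+)

    -- A single element of order p from Cauchy's theorem is enough: automorphisms carry it to every
    -- nontrivial element of every `P j`, and the remaining elements are products of two commuting
    -- ones of exponent p.
    prime-exponent : ∃[ p ] (Prime p × ∀ x → p times x ≡ ε)
    prime-exponent =
      let p , p-prime , p∣P = prime-divisor (order (P≤ i₀)) order≢1
          x , Px , x≢ε , px≡ε = cauchy (P≤ i₀) p-prime p∣P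
      in p , p-prime , exponent p x Px x≢ε px≡ε
      where
      module _ (p : ℕ) (x : A) (Px : P i₀ x) (x≢ε : x ≢ ε) (px≡ε : p times x ≡ ε) where

        exponent-P : ∀ j {y} → P j y → p times y ≡ ε
        exponent-P j {y} Py with y ≟ ε
        ... | yes y≡ε = trans (cong (p times_) y≡ε) (times-ε p)
        ... | no  y≢ε = let g , gx≡y = element-transitive Px x≢ε Py y≢ε in
          trans (cong (p times_) (sym gx≡y)) (trans (sym (to-times g p x)) (trans (cong (to g) px≡ε) (to-ε g)))

        exponent : ∀ y → p times y ≡ ε
        exponent y = let j , i≢j = other i₀ ; b , Pb , Qc = factor i≢j y in begin
          p times y                               ≡⟨ cong (p times_) (\\-leftDividesˡ b y) ⟨
          p times (b ∙ ((b ⁻¹) ∙ y))              ≡⟨ ×-distrib-+ b _ p ⟩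
          (p times b) ∙ (p times ((b ⁻¹) ∙ y))    ≡⟨ cong₂ _∙_ (exponent-P i₀ Pb) (exponent-P j Qc) ⟩
          ε ∙ ε                                   ≡⟨ identityˡ ε ⟩
          ε                                       ∎
          where open ≡-Reasoning

  -- Bases of commutative groups of prime exponent

  record CoordinateSystem (p d : ℕ) .{{_ : NonZero p}} : Set where
    open VectorSpace p d
    field
      element        : V → A
      vector         : A → V
      element-vector : ∀ x → element (vector x) ≡ x
      vector-element : ∀ v → vector (element v) ≡ v
      element-0      : element 0ᵛ ≡ ε
      element-+      : ∀ v w → element (v +ᵛ w) ≡ element v ∙ element w
      element-·      : ∀ c v → element (c ·ᵛ v) ≡ Fin.toℕ c times element v

  module Coordinates (comm : Commutative _≡_ _∙_) {p : ℕ} (p-prime : Prime p) (exponent : ∀ x → p times x ≡ ε) where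
    open Algebra.Properties.CommutativeMonoid.Mult (commutativeMonoid comm) using (×-distrib-+)
    open CommutativeSemigroup (CommutativeMonoid.commutativeSemigroup (commutativeMonoid comm)) using (interchange)

    instance
      p≢0 : NonZero p
      p≢0 = prime⇒nonZero p-prime

    open module VS {d} = VectorSpace p d using (_+ᵛ_; _·ᵛ_; 0ᵛ)

    times-mod : ∀ k x → Fin.toℕ (k mod p) times x ≡ k times x
    times-mod k x = begin
      Fin.toℕ (k mod p) times x                   ≡⟨ cong (_times x) (Fin.toℕ-fromℕ< (m%n<n k p)) ⟩
      (k % p) times x                             ≡⟨ identityʳ _ ⟨
      ((k % p) times x) ∙ ε                       ≡⟨ cong (((k % p) times x) ∙_) (times-multiple (k / p) p (exponent x)) ⟨
      ((k % p) times x) ∙ ((k / p * p) times x)   ≡⟨ ×-homo-+ x (k % p) _ ⟨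
      (k % p + k / p * p) times x                 ≡⟨ cong (_times x) (m≡m%n+[m/n]*n k p) ⟨
      k times x                                   ∎
      where open ≡-Reasoning

    combination : ∀ {d} → Vec A d → Vec (Fin p) d → A
    combination []       []       = ε
    combination (b ∷ bs) (c ∷ cs) = (Fin.toℕ c times b) ∙ combination bs cs

    combination-+ : ∀ {d} (bs : Vec A d) v w →
                    combination bs (v +ᵛ w) ≡ combination bs v ∙ combination bs w
    combination-+ []       []       []       = sym (identityˡ ε)
    combination-+ (b ∷ bs) (c ∷ v) (e ∷ w) = trans
      (cong₂ _∙_ (trans (times-mod (Fin.toℕ c + Fin.toℕ e) b) (×-homo-+ b (Fin.toℕ c) (Fin.toℕ e)))
                 (combination-+ bs v w))
      (interchange _ _ _ _)

    combination-· : ∀ {d} (bs : Vec A d) c v →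
                    combination bs (c ·ᵛ v) ≡ Fin.toℕ c times combination bs v
    combination-· []       c []      = sym (times-ε (Fin.toℕ c))
    combination-· (b ∷ bs) c (e ∷ v) = trans
      (cong₂ _∙_ (trans (times-mod (Fin.toℕ c * Fin.toℕ e) b) (sym (×-assocˡ b (Fin.toℕ c) (Fin.toℕ e))))
                 (combination-· bs c v))
      (sym (×-distrib-+ _ _ (Fin.toℕ c)))

    combination-0 : ∀ {d} (bs : Vec A d) → combination bs 0ᵛ ≡ ε
    combination-0 []       = refl
    combination-0 (b ∷ bs) = trans (cong₂ _∙_ (times-mod 0 b) (combination-0 bs)) (identityˡ ε)

    Span : ∀ {d} → Vec A d → Pred A 0ℓ
    Span {d} bs x = ∃[ v ] combination {d} bs v ≡ x

    span? : ∀ {d} (bs : Vec A d) → Decidable (Span bs)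
    span? bs x = ∃? (finite-Vec (finite-Fin p) _) λ v → combination bs v ≟ x

    module _ {d} {bs : Vec A d} where

      span-∙ : ∀ {x y} → Span bs x → Span bs y → Span bs (x ∙ y)
      span-∙ (v , refl) (w , refl) = v +ᵛ w , combination-+ bs v w

      span-times : ∀ k {x} → Span bs x → Span bs (k times x)
      span-times k (v , refl) = (k mod p) ·ᵛ v , trans (combination-· bs (k mod p) v) (times-mod k _)

      span-⁻¹ : ∀ {x} → Span bs x → Span bs (x ⁻¹)
      span-⁻¹ {x} s = subst (Span bs)
        (inverseʳ-unique x _ (trans (cong (_times x) (suc-pred p)) (exponent x))) (span-times (ℕ.pred p) s)

      -- The factor e is invertible modulo p, with its inverse (up to sign) taken from a Bézout
      -- identity.
      span-root : ∀ {e x} .{{_ : NonZero e}} → e < p → Span bs (e times x) → Span bs x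
      span-root {e} {x} e<p s with coprime-Bézout (prime⇒coprime p-prime e<p)
      ... | Bézout.+- a b eq = subst (Span bs)
              (sym (inverseˡ-unique x _ (trans (cong (_times x) eq) (times-multiple a p (exponent x)))))
              (span-⁻¹ (subst (Span bs) (×-assocˡ x b e) (span-times b s)))
      ... | Bézout.-+ a b eq = subst (Span bs) (begin
              b times (e times x)        ≡⟨ ×-assocˡ x b e ⟩
              (b * e) times x            ≡⟨ cong (_times x) eq ⟨
              x ∙ ((a * p) times x)      ≡⟨ cong (x ∙_) (times-multiple a p (exponent x)) ⟩
              x ∙ ε                      ≡⟨ identityʳ x ⟩
              x                          ∎) (span-times b s)
              where open ≡-Reasoning

      span-collision : ∀ {x a b v w} → a < b → b < p →
                       (a times x) ∙ combination bs v ≡ (b times x) ∙ combination bs w → Span bs x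
      span-collision {x} {a} {b} {v} {w} a<b b<p e = span-root {{ℕ.>-nonZero (m<n⇒0<n∸m a<b)}} (≤-<-trans (m∸n≤m b a) b<p)
        (subst (Span bs) (sym difference) (span-∙ (v , refl) (span-⁻¹ (w , refl))))
        where
        open ≡-Reasoning
        difference : (b ∸ a) times x ≡ combination bs v ∙ (combination bs w ⁻¹)
        difference = begin
          (b ∸ a) times x
            ≡⟨ //-rightDividesʳ (combination bs w) _ ⟨
          (((b ∸ a) times x) ∙ combination bs w) ∙ (combination bs w ⁻¹)
            ≡⟨ cong (_∙ (combination bs w ⁻¹)) (∙-cancelˡ (a times x) _ _ (begin
              (a times x) ∙ (((b ∸ a) times x) ∙ combination bs w) ≡⟨ assoc _ _ _ ⟨
              ((a times x) ∙ ((b ∸ a) times x)) ∙ combination bs w ≡⟨ cong (_∙ combination bs w) (×-homo-+ x a (b ∸ a)) ⟨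
              ((a + (b ∸ a)) times x) ∙ combination bs w
                ≡⟨ cong (λ k → (k times x) ∙ combination bs w) (m+[n∸m]≡n (<⇒≤ a<b)) ⟩
              (b times x) ∙ combination bs w                       ≡⟨ e ⟨
              (a times x) ∙ combination bs v                       ∎)) ⟩
          combination bs v ∙ (combination bs w ⁻¹) ∎

      -- Independence is phrased as uniqueness of coordinates, which is what `vector-element` asks
      -- for. Two different leading coefficients would put a multiple of x by a nonzero residue, and
      -- with it x, into the span.
      extend-independent : Injective _≡_ _≡_ (combination bs) → ∀ {x} → ¬ Span bs x →
                           Injective _≡_ _≡_ (combination (x ∷ bs))
      extend-independent independent {x} x∉ {a ∷ v} {b ∷ w} e with <-cmp (Fin.toℕ a) (Fin.toℕ b)
      ... | tri< a<b _ _ = contradiction (span-collision {v = v} {w} a<b (Fin.toℕ<n b) e) x∉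
      ... | tri> _ _ b<a = contradiction (span-collision {v = w} {v} b<a (Fin.toℕ<n a) (sym e)) x∉
      ... | tri≈ _ a≡b _ with refl ← Fin.toℕ-injective a≡b = cong (a ∷_) (independent (∙-cancelˡ _ _ _ e))

      span-extend : ∀ {x y} → Span bs y → Span (x ∷ bs) y
      span-extend {x} (v , refl) = (0 mod p) ∷ v , trans (cong (_∙ combination bs v) (times-mod 0 x)) (identityˡ _)

      span-new : ∀ {x} → Span (x ∷ bs) x
      span-new {x} = (1 mod p) ∷ 0ᵛ , trans (cong₂ _∙_ (times-mod 1 x) (combination-0 bs))
                                            (trans (identityʳ _) (identityʳ x))

    -- Greedy choice: an element is kept only if it lies outside the span of those already kept.
    -- Applied to the list of all elements it yields a basis.
    independent-spanning : (xs : List A) → ∃[ d ] Σ[ bs ∈ Vec A d ]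
      (Injective _≡_ _≡_ (combination bs) × ∀ {x} → Any (x ≡_) xs → Span bs x)
    independent-spanning [] = 0 , [] , (λ { {[]} {[]} _ → refl }) , λ ()
    independent-spanning (x ∷ xs) with d , bs , independent , spanning ← independent-spanning xs
      with span? bs x
    ... | yes x∈ = d , bs , independent , λ { (here refl) → x∈ ; (there y∈xs) → spanning y∈xs }
    ... | no  x∉ = suc d , x ∷ bs , extend-independent independent x∉ ,
                   λ { (here refl) → span-new ; (there y∈xs) → span-extend (spanning y∈xs) }

    private
      basis = independent-spanning (elements F)

    dimension : ℕ
    dimension = proj₁ basis

    coordinates : CoordinateSystem p dimension
    coordinates = let _ , bs , independent , spanning = basis in record
      { element        = combination bs
      ; vector         = λ x → proj₁ (spanning (∈-elements F x))
      ; element-vector = λ x → proj₂ (spanning (∈-elements F x))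
      ; vector-element = λ v → independent (proj₂ (spanning (∈-elements F (combination bs v))))
      ; element-0      = combination-0 bs
      ; element-+      = combination-+ bs
      ; element-·      = combination-· bs
      }

-- Nicely affine designs with a regular group

-- 𝒢 is any type acting on points and blocks like a group: its laws are only required of the two actions. The values
-- of `class` stand for the orbits of N on blocks.
record AffineGeometry (r : ℕ) : Set₁ where
  infixr 8 _·_ _∗_
  infixr 9 _∘ᴳ_
  field
    n m : ℕ
    I   : Fin n → Fin m → Set
    I?  : ∀ a c → Dec (I a c)

    𝒢    : Set
    _·_  : 𝒢 → Fin n → Fin n
    _∗_  : 𝒢 → Fin m → Fin m
    _∘ᴳ_ : 𝒢 → 𝒢 → 𝒢
    1ᴳ   : 𝒢
    inv  : 𝒢 → 𝒢

    ·-1    : ∀ a → 1ᴳ · a ≡ a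
    ·-∘    : ∀ g h a → (g ∘ᴳ h) · a ≡ g · h · a
    ·-invˡ : ∀ g a → inv g · g · a ≡ a
    ·-invʳ : ∀ g a → g · inv g · a ≡ a
    ∗-∘    : ∀ g h c → (g ∘ᴳ h) ∗ c ≡ g ∗ h ∗ c
    ∗-invˡ : ∀ g c → inv g ∗ g ∗ c ≡ c
    I-map  : ∀ g {a c} → I a c → I (g · a) (g ∗ c)

    N        : Pred 𝒢 0ℓ
    N-∘      : ∀ {g h} → N g → N h → N (g ∘ᴳ h)
    N-inv    : ∀ {g} → N g → N (inv g)
    N-normal : ∀ g {h} → N h → N ((g ∘ᴳ h) ∘ᴳ inv g)

    N-transitive : ∀ a b → ∃[ g ] (N g × g · a ≡ b)
    N-semiregular : ∀ {g a} → N g → g · a ≡ a → ∀ b → g · b ≡ b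

    class            : Fin m → Fin r
    class-N          : ∀ {g c} → N g → class (g ∗ c) ≡ class c
    N-class          : ∀ {c d} → class c ≡ class d → ∃[ g ] (N g × g ∗ c ≡ d)
    class-surjective : ∀ i → ∃[ c ] class c ≡ i

    parallel    : ∀ {a c d} → class c ≡ class d → I a c → I a d → c ≡ d
    meet        : ∀ {c d} → class c ≢ class d → ∃[ a ] (I a c × I a d)
    inhabited   : ∀ c → ∃[ a ] I a c
    nonincident : ∃[ a ] ∃[ c ] ¬ I a c

    transitive-I : ∀ {a c a′ c′} → I a c → I a′ c′ → ∃[ g ] (g · a ≡ a′ × g ∗ c ≡ c′)
    transitive-¬I : ∀ {a c a′ c′} → ¬ I a c → ¬ I a′ c′ → ∃[ g ] (g · a ≡ a′ × g ∗ c ≡ c′)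

  Collinear′ : Rel (Fin n) 0ℓ
  Collinear′ a b = ∃[ c ] (I a c × I b c)

  field
    transitive-collinear : ∀ {a b a′ b′} → a ≢ b → Collinear′ a b → a′ ≢ b′ → Collinear′ a′ b′ →
                           ∃[ g ] (g · a ≡ a′ × g · b ≡ b′)
    transitive-noncollinear : ∀ {a b a′ b′} → a ≢ b → ¬ Collinear′ a b → a′ ≢ b′ → ¬ Collinear′ a′ b′ →
                              ∃[ g ] (g · a ≡ a′ × g · b ≡ b′)
    transitive-intersecting : ∀ {c d c′ d′} → c ≢ d → (∃[ a ] (I a c × I a d)) →
                              c′ ≢ d′ → (∃[ a ] (I a c′ × I a d′)) →
                              ∃[ g ] (g ∗ c ≡ c′ × g ∗ d ≡ d′)

module TranslationGroup {r : ℕ} (geometry : AffineGeometry r) (o : Fin (AffineGeometry.n geometry)) where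
  open AffineGeometry geometry

  Points : Finite (Fin n)
  Points = finite-Fin n

  -- Regularity in its working form: an element of N is determined by the image of one point.
  -- Associativity and `fixing-homo` are proved by evaluating both sides at `o`.
  agree-· : ∀ {g h a} → N g → N h → g · a ≡ h · a → ∀ b → g · b ≡ h · b
  agree-· {g} {h} {a} Ng Nh ga≡ha b = begin
    g · b                 ≡⟨ ·-invʳ h (g · b) ⟨
    h · inv h · g · b     ≡⟨ cong (h ·_) (·-∘ (inv h) g b) ⟨
    h · (inv h ∘ᴳ g) · b  ≡⟨ cong (h ·_) (N-semiregular (N-∘ (N-inv Nh) Ng)
                               (trans (·-∘ (inv h) g a) (trans (cong (inv h ·_) ga≡ha) (·-invˡ h a))) b) ⟩
    h · b                 ∎
    where open ≡-Reasoning

  τ : Fin n → 𝒢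
  τ a = proj₁ (N-transitive o a)

  N-τ : ∀ a → N (τ a)
  N-τ a = proj₁ (proj₂ (N-transitive o a))

  τ-o : ∀ a → τ a · o ≡ a
  τ-o a = proj₂ (proj₂ (N-transitive o a))

  infixl 7 _∙_
  -- The multiplication of N transported to the points along a ↦ `τ a`. Left multiplication by a
  -- point is its translation, so left cosets are images of blocks under N.
  _∙_ : Op₂ (Fin n)
  a ∙ b = τ a · b

  _⁻¹ : Op₁ (Fin n)
  a ⁻¹ = inv (τ a) · o

  translation : ∀ {g} → N g → ∀ b → g · b ≡ (g · o) ∙ b
  translation {g} Ng = agree-· Ng (N-τ (g · o)) (sym (τ-o (g · o)))

  ⁻¹-∙ : ∀ a b → (a ⁻¹) ∙ b ≡ inv (τ a) · b
  ⁻¹-∙ a b = sym (translation (N-inv (N-τ a)) b)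

  ∙-identityˡ : ∀ b → o ∙ b ≡ b
  ∙-identityˡ b = N-semiregular (N-τ o) (τ-o o) b

  ∙-assoc : ∀ a b c → (a ∙ b) ∙ c ≡ a ∙ (b ∙ c)
  ∙-assoc a b c = begin
    τ (τ a · b) · c       ≡⟨ agree-· (N-τ _) (N-∘ (N-τ a) (N-τ b))
                               (trans (τ-o _) (sym (trans (·-∘ (τ a) (τ b) o) (cong (τ a ·_) (τ-o b))))) c ⟩
    (τ a ∘ᴳ τ b) · c      ≡⟨ ·-∘ (τ a) (τ b) c ⟩
    τ a · τ b · c         ∎
    where open ≡-Reasoning

  ∙-inverseˡ : ∀ a → (a ⁻¹) ∙ a ≡ o
  ∙-inverseˡ a = trans (⁻¹-∙ a a) (trans (cong (inv (τ a) ·_) (sym (τ-o a))) (·-invˡ (τ a) o))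

  ∙-isGroup : IsGroup _≡_ _∙_ o _⁻¹
  ∙-isGroup = record
    { isMonoid = record
      { isSemigroup = record
        { isMagma = record { isEquivalence = isEquivalence ; ∙-cong = cong₂ _∙_ }
        ; assoc = ∙-assoc
        }
      ; identity = ∙-identityˡ , τ-o
      }
    ; inverse = ∙-inverseˡ , λ a → ·-invʳ (τ a) o
    ; ⁻¹-cong = cong _⁻¹
    }

  open FiniteGroup Points ∙-isGroup public
    using (group; IsSubgroup; Automorphism; Maps; CoordinateSystem; module TransitiveFactorisation; module Coordinates)
  open Algebra.Properties.Group group

  I-unmap : ∀ g {a c} → I (g · a) (g ∗ c) → I a c
  I-unmap g {a} {c} i = subst₂ I (·-invˡ g a) (∗-invˡ g c) (I-map (inv g) i)

  -- The block of class i through `o`, obtained by translating some point of some block of the class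
  -- back to `o`.
  α : Fin r → Fin m
  α i = let c , _ = class-surjective i ; a , _ = inhabited c in inv (τ a) ∗ c

  class-α : ∀ i → class (α i) ≡ i
  class-α i = trans (class-N (N-inv (N-τ _))) (proj₂ (class-surjective i))

  o∈α : ∀ i → I o (α i)
  o∈α i = let c , _ = class-surjective i ; a , a∈c = inhabited c in
    subst (λ b → I b (α i)) (trans (cong (inv (τ a) ·_) (sym (τ-o a))) (·-invˡ (τ a) o)) (I-map (inv (τ a)) a∈c)

  α-unique : ∀ {i c} → class c ≡ i → I o c → c ≡ α i
  α-unique {i} refl o∈c = parallel (sym (class-α i)) o∈c (o∈α i)

  P : Fin r → Pred (Fin n) 0ℓ
  P i a = I a (α i)

  ∈-translate : ∀ i a → I a (τ a ∗ α i)
  ∈-translate i a = subst (λ b → I b (τ a ∗ α i)) (τ-o a) (I-map (τ a) (o∈α i))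

  -- `α i` and its translate are parallel and share the point a, so they are equal. Closure of `P i`
  -- under products and inverses rests on this.
  translate-own : ∀ {i a} → P i a → τ a ∗ α i ≡ α i
  translate-own {i} {a} Pa = parallel (class-N (N-τ a)) (∈-translate i a) Pa

  P-isSubgroup : ∀ i → IsSubgroup (P i)
  P-isSubgroup i = record
    { member?   = λ a → I? a (α i)
    ; ε-closed  = o∈α i
    ; ∙-closed  = λ {a} {b} Pa Pb → subst (I (a ∙ b)) (translate-own Pa) (I-map (τ a) Pb)
    ; ⁻¹-closed = λ {a} Pa → subst (I (a ⁻¹))
        (trans (cong (inv (τ a) ∗_) (sym (translate-own Pa))) (∗-invˡ (τ a) (α i))) (I-map (inv (τ a)) (o∈α i))
    }

  ∈-translate⇒ : ∀ {i a x} → I x (τ a ∗ α i) → P i ((a ⁻¹) ∙ x)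
  ∈-translate⇒ {i} {a} {x} x∈ = subst₂ I (sym (⁻¹-∙ a x)) (∗-invˡ (τ a) (α i)) (I-map (inv (τ a)) x∈)

  ∈-translate⇐ : ∀ {i a x} → P i ((a ⁻¹) ∙ x) → I x (τ a ∗ α i)
  ∈-translate⇐ {i} {a} {x} p = subst (λ b → I b (τ a ∗ α i)) (\\-leftDividesˡ a x) (I-map (τ a) p)

  block≡translate : ∀ {a c} → I a c → c ≡ τ a ∗ α (class c)
  block≡translate {a} {c} a∈c = parallel (sym (trans (class-N (N-τ a)) (class-α _))) a∈c (∈-translate (class c) a)

  -- If h in N takes c to d, then the conjugate ghg⁻¹, again in N, takes g ∗ c to g ∗ d.
  class-map : ∀ g {c d} → class c ≡ class d → class (g ∗ c) ≡ class (g ∗ d)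
  class-map g {c} {d} c∥d = let h , Nh , hc≡d = N-class c∥d in begin
    class (g ∗ c)                          ≡⟨ class-N (N-normal g Nh) ⟨
    class (((g ∘ᴳ h) ∘ᴳ inv g) ∗ g ∗ c)    ≡⟨ cong class (∗-∘ (g ∘ᴳ h) (inv g) _) ⟩
    class ((g ∘ᴳ h) ∗ inv g ∗ g ∗ c)       ≡⟨ cong (λ e → class ((g ∘ᴳ h) ∗ e)) (∗-invˡ g c) ⟩
    class ((g ∘ᴳ h) ∗ c)                   ≡⟨ cong class (trans (∗-∘ g h c) (cong (g ∗_) hc≡d)) ⟩
    class (g ∗ d)                          ∎
    where open ≡-Reasoning

  -- The conjugate of `τ a` by g lies in N and takes `o` to g · a, so it acts as the translation
  -- `τ (g · a)`.
  fixing-homo : ∀ g → g · o ≡ o → ∀ a b → g · (a ∙ b) ≡ (g · a) ∙ (g · b)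
  fixing-homo g go≡o a b = begin
    g · τ a · b                               ≡⟨ cong (λ c → g · τ a · c) (·-invˡ g b) ⟨
    g · τ a · inv g · g · b                   ≡⟨ ·-∘ g (τ a) _ ⟨
    (g ∘ᴳ τ a) · inv g · g · b                ≡⟨ ·-∘ _ (inv g) _ ⟨
    ((g ∘ᴳ τ a) ∘ᴳ inv g) · g · b             ≡⟨ agree-· (N-normal g (N-τ a)) (N-τ (g · a)) (begin
      ((g ∘ᴳ τ a) ∘ᴳ inv g) · o                 ≡⟨ ·-∘ _ (inv g) o ⟩
      (g ∘ᴳ τ a) · inv g · o                    ≡⟨ cong (λ c → (g ∘ᴳ τ a) · inv g · c) go≡o ⟨
      (g ∘ᴳ τ a) · inv g · g · o                ≡⟨ cong ((g ∘ᴳ τ a) ·_) (·-invˡ g o) ⟩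
      (g ∘ᴳ τ a) · o                            ≡⟨ ·-∘ g (τ a) o ⟩
      g · τ a · o                               ≡⟨ cong (g ·_) (τ-o a) ⟩
      g · a                                     ≡⟨ τ-o (g · a) ⟨
      τ (g · a) · o                             ∎) (g · b) ⟩
    τ (g · a) · g · b                         ∎
    where open ≡-Reasoning

  automorphism : ∀ g → g · o ≡ o → Automorphism
  automorphism g go≡o = record
    { to = g ·_ ; from = inv g ·_ ; from-to = ·-invˡ g ; to-from = ·-invʳ g ; homo = fixing-homo g go≡o }

  maps-α : ∀ g {i j} → g ∗ α i ≡ α j → (∀ {x} → P i x → P j (g · x)) × (∀ {x} → P j (g · x) → P i x)
  maps-α g {i} {j} gα≡α = (λ {x} Px → subst (I (g · x)) gα≡α (I-map g Px))
                        , (λ {x} Pgx → I-unmap g (subst (I (g · x)) (sym gα≡α) Pgx))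

  permutes-α : ∀ g → g · o ≡ o → ∀ i → ∃[ j ] g ∗ α i ≡ α j
  permutes-α g go≡o i = class (g ∗ α i) , α-unique refl (subst (λ a → I a (g ∗ α i)) go≡o (I-map g (o∈α i)))

  α-transitive : ∀ i j → ∃[ g ] (g · o ≡ o × g ∗ α i ≡ α j)
  α-transitive i j = transitive-I (o∈α i) (o∈α j)

  α-distinct : ∀ {i j} → i ≢ j → α i ≢ α j
  α-distinct {i} {j} i≢j e = i≢j (trans (sym (class-α i)) (trans (cong class e) (class-α j)))

  -- Transitivity on intersecting blocks may move `o` to another common point b of the image blocks.
  -- Translating b back to `o` repairs this and fixes both blocks, since b lies on each.
  α-2-transitive : ∀ {i j k l} → i ≢ j → k ≢ l → ∃[ g ] (g · o ≡ o × g ∗ α i ≡ α k × g ∗ α j ≡ α l)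
  α-2-transitive {i} {j} {k} {l} i≢j k≢l =
    let g , gαi≡αk , gαj≡αl = transitive-intersecting (α-distinct i≢j) (o , o∈α i , o∈α j)
                                                      (α-distinct k≢l) (o , o∈α k , o∈α l)
        b = g · o
        fix = λ {s t} (e : g ∗ α s ≡ α t) → let b∈αt = proj₁ (maps-α g e) (o∈α s) in
                trans (∗-∘ (inv (τ b)) g (α s)) (trans (cong (inv (τ b) ∗_) (trans e (sym (translate-own b∈αt))))
                  (∗-invˡ (τ b) (α t)))
    in inv (τ b) ∘ᴳ g
     , trans (·-∘ (inv (τ b)) g o) (trans (cong (inv (τ b) ·_) (sym (τ-o b))) (·-invˡ (τ b) o))
     , fix gαi≡αk , fix gαj≡αl

  -- A common point of `α i` and the translate of `α j` by x serves as the first factor.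
  factor : ∀ {i j} → i ≢ j → ∀ x → ∃[ a ] (P i a × P j ((a ⁻¹) ∙ x))
  factor {i} {j} i≢j x = let a , Pa , a∈ = meet (λ e → i≢j (trans (sym (class-α i)) (trans e
                                             (trans (class-N (N-τ x)) (class-α j))))) in
    a , Pa , subst (P j) (⁻¹-anti-homo-\\ x a) (IsSubgroup.⁻¹-closed (P-isSubgroup j) (∈-translate⇒ a∈))

  -- A non-incident pair shows properness for the class of its block; the stabiliser of `o` carries
  -- it to all other classes.
  proper : ∀ i → ∃[ x ] ¬ P i x
  proper i =
    let a , c , a∉c = nonincident
        b , b∈c     = inhabited c
        j           = class c
        g , _ , gα  = α-transitive i j
        y           = (b ⁻¹) ∙ a
        y∉P         = λ Py → a∉c (subst (I a) (sym (block≡translate b∈c)) (∈-translate⇐ Py))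
    in inv g · y , λ Px → y∉P (subst (P j) (·-invʳ g y) (proj₁ (maps-α g gα) Px))

  -- The two cosets are blocks that miss `o`, so some g fixing `o` takes one to the other. As g
  -- respects parallelism, it also keeps the class i and hence fixes `α i`.
  coset-transitive : ∀ {i x y} → ¬ P i x → ¬ P i y →
                     ∃[ g ] (g · o ≡ o × g ∗ α i ≡ α i × g ∗ τ x ∗ α i ≡ τ y ∗ α i)
  coset-transitive {i} {x} {y} x∉P y∉P =
    let g , go≡o , e = transitive-¬I (o∉ x∉P) (o∉ y∉P)
        j , gα≡α     = permutes-α g go≡o i
        i≡j          = begin
          i                      ≡⟨ class-α i ⟨
          class (α i)            ≡⟨ class-N (N-τ y) ⟨
          class (τ y ∗ α i)      ≡⟨ cong class e ⟨
          class (g ∗ τ x ∗ α i)  ≡⟨ class-map g (class-N (N-τ x)) ⟩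
          class (g ∗ α i)        ≡⟨ cong class gα≡α ⟩
          class (α j)            ≡⟨ class-α j ⟩
          j                      ∎
    in g , go≡o , trans gα≡α (cong α (sym i≡j)) , e
    where
    open ≡-Reasoning
    o∉ : ∀ {x} → ¬ P i x → ¬ I o (τ x ∗ α i)
    o∉ {x} x∉P o∈ = x∉P (subst (P i) (trans (cong _⁻¹ (τ-o (x ⁻¹))) (⁻¹-involutive x))
      (IsSubgroup.⁻¹-closed (P-isSubgroup i) (∈-translate⇒ o∈)))

  collinear-o : ∀ {i x} → P i x → Collinear′ o x
  collinear-o {i} Px = α i , o∈α i , Px

  element-transitive : ∀ {i j x y} → P i x → x ≢ o → P j y → y ≢ o → ∃[ g ] (g · o ≡ o × g · x ≡ y)
  element-transitive Px x≢o Py y≢o =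
    transitive-collinear (x≢o ∘ sym) (collinear-o Px) (y≢o ∘ sym) (collinear-o Py)

  module _ {i₀ i₁ : Fin r} (i₀≢i₁ : i₀ ≢ i₁) where

    other : ∀ i → ∃[ j ] i ≢ j
    other i with i Fin.≟ i₀
    ... | yes i≡i₀ = i₁ , λ i≡i₁ → i₀≢i₁ (trans (sym i≡i₀) i≡i₁)
    ... | no  i≢i₀ = i₀ , i≢i₀

    index-transitive : ∀ i j → ∃[ γ ] Maps γ (P i) (P j)
    index-transitive i j = let g , go≡o , gα≡α = α-transitive i j in automorphism g go≡o , maps-α g gα≡α

    coset-transitive′ : ∀ {i x y} → ¬ P i x → ¬ P i y →
                        ∃[ γ ] (Maps γ (P i) (P i) × P i ((y ⁻¹) ∙ Automorphism.to γ x))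
    coset-transitive′ {i} {x} x∉P y∉P = let g , go≡o , gα≡α , e = coset-transitive x∉P y∉P in
      automorphism g go≡o , maps-α g gα≡α ,
      ∈-translate⇒ (subst (I (g · x)) e (I-map g (∈-translate i x)))

    element-transitive′ : ∀ {i j x y} → P i x → x ≢ o → P j y → y ≢ o → ∃[ γ ] Automorphism.to γ x ≡ y
    element-transitive′ Px x≢o Py y≢o = let g , go≡o , gx≡y = element-transitive Px x≢o Py y≢o in
      automorphism g go≡o , gx≡y

    open TransitiveFactorisation P P-isSubgroup factor proper i₀ other
      index-transitive coset-transitive′ element-transitive′
      public using (commutative; prime-exponent)

-- The vector space construction

first≢second : ∀ {r} (3≤r : 3 ≤ r) → inject≤ 0F 3≤r ≢ inject≤ 1F 3≤r
first≢second 3≤r e =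
  contradiction (trans (sym (Fin.toℕ-inject≤ 0F 3≤r)) (trans (cong Fin.toℕ e) (Fin.toℕ-inject≤ 1F 3≤r))) λ ()

module Construction
  {r : ℕ} (geometry : AffineGeometry r) (o : Fin (AffineGeometry.n geometry)) (3≤r : 3 ≤ r)
  {p d : ℕ} .{{_ : NonZero p}} (coordinates : TranslationGroup.CoordinateSystem geometry o p d)
  where
  open AffineGeometry geometry
  open TranslationGroup geometry o
  open VectorSpace p d
  open Algebra.Properties.Monoid.Mult (Group.monoid group) renaming (_×_ to _times_)
  open FiniteGroup.CoordinateSystem coordinates
  open Algebra.Properties.Group group using (\\-leftDividesˡ; \\-leftDividesʳ)
  open IsSubgroup

  vector-+ : ∀ a b → vector (a ∙ b) ≡ vector a +ᵛ vector b
  vector-+ a b = begin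
    vector (a ∙ b)                                      ≡⟨ cong vector (cong₂ _∙_ (element-vector a) (element-vector b)) ⟨
    vector (element (vector a) ∙ element (vector b))    ≡⟨ cong vector (element-+ _ _) ⟨
    vector (element (vector a +ᵛ vector b))             ≡⟨ vector-element _ ⟩
    vector a +ᵛ vector b                                ∎
    where open ≡-Reasoning

  vector-times : ∀ c a → vector (Fin.toℕ c times a) ≡ c ·ᵛ vector a
  vector-times c a = begin
    vector (Fin.toℕ c times a)                   ≡⟨ cong (λ b → vector (Fin.toℕ c times b)) (element-vector a) ⟨
    vector (Fin.toℕ c times element (vector a))  ≡⟨ cong vector (element-· c _) ⟨
    vector (element (c ·ᵛ vector a))             ≡⟨ vector-element _ ⟩
    c ·ᵛ vector a                                ∎
    where open ≡-Reasoning

  induced : 𝒢 → Perm VSetoid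
  induced g = record
    { to        = λ v → vector (g · element v)
    ; from      = λ v → vector (inv g · element v)
    ; to-cong   = cong _
    ; from-cong = cong _
    ; inverse   = (λ { refl → trans (cong (λ a → vector (g · a)) (element-vector _))
                                (trans (cong vector (·-invʳ g _)) (vector-element _)) })
                , (λ { refl → trans (cong (λ a → vector (inv g · a)) (element-vector _))
                                (trans (cong vector (·-invˡ g _)) (vector-element _)) })
    }

  -- A pointwise relation, because membership in a permutation group must be stable under pointwise
  -- equality.
  _Induces_ : 𝒢 → Perm VSetoid → Set
  g Induces h = ∀ v → h ⟨$⟩ v ≡ vector (g · element v)

  Induced : (Q : Pred 𝒢 0ℓ) → Q 1ᴳ → (∀ {g h} → Q g → Q h → Q (g ∘ᴳ h)) → (∀ {g} → Q g → Q (inv g)) →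
            PermGroup VSetoid
  Induced Q Q-1 Q-∘ Q-inv = record
    { Member    = λ h → ∃[ g ] (Q g × g Induces h)
    ; resp      = λ { h≈k (g , Qg , e) → g , Qg , λ v → trans (sym (h≈k v)) (e v) }
    ; ε-closed  = 1ᴳ , Q-1 , λ v → sym (trans (cong vector (·-1 _)) (vector-element v))
    ; ∙-closed  = λ { {h} {k} (g , Qg , e) (f , Qf , e′) → g ∘ᴳ f , Q-∘ Qg Qf , λ v → begin
        h ⟨$⟩ k ⟨$⟩ v                               ≡⟨ e _ ⟩
        vector (g · element (k ⟨$⟩ v))              ≡⟨ cong (λ w → vector (g · element w)) (e′ v) ⟩
        vector (g · element (vector (f · element v))) ≡⟨ cong (λ a → vector (g · a)) (element-vector _) ⟩
        vector (g · f · element v)                  ≡⟨ cong vector (·-∘ g f _) ⟨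
        vector ((g ∘ᴳ f) · element v)               ∎ }
    ; ⁻¹-closed = λ { {h} (g , Qg , e) → inv g , Q-inv Qg , λ v → begin
        Inverse.from h v
          ≡⟨ cong (Inverse.from h) (Inverse.strictlyInverseˡ (induced g) v) ⟨
        Inverse.from h (induced g ⟨$⟩ vector (inv g · element v))
          ≡⟨ cong (Inverse.from h) (e _) ⟨
        Inverse.from h (h ⟨$⟩ vector (inv g · element v))
          ≡⟨ Inverse.strictlyInverseʳ h _ ⟩
        vector (inv g · element v) ∎ }
    }
    where open ≡-Reasoning

  Ĝ Ĝ₀ : PermGroup VSetoid
  Ĝ  = Induced U tt (λ _ _ → tt) (λ _ → tt)
  Ĝ₀ = Induced (λ g → g · o ≡ o) (·-1 o)
         (λ {g} {h} go≡o ho≡o → trans (·-∘ g h o) (trans (cong (g ·_) ho≡o) go≡o))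
         (λ {g} go≡o → trans (cong (inv g ·_) (sym go≡o)) (·-invˡ g o))

  induced-Ĝ : ∀ g → induced g ∈ Member Ĝ
  induced-Ĝ g = g , tt , λ _ → refl

  induced-Ĝ₀ : ∀ {g} → g · o ≡ o → induced g ∈ Member Ĝ₀
  induced-Ĝ₀ {g} go≡o = g , go≡o , λ _ → refl

  Ĝ₀-linear : ∀ h → h ∈ Member Ĝ₀ → IsLinear h
  Ĝ₀-linear h (g , go≡o , e) = additive , homogeneous
    where
    open ≡-Reasoning
    additive : ∀ v w → h ⟨$⟩ (v +ᵛ w) ≡ (h ⟨$⟩ v) +ᵛ (h ⟨$⟩ w)
    additive v w = begin
      h ⟨$⟩ (v +ᵛ w)                                   ≡⟨ e _ ⟩
      vector (g · element (v +ᵛ w))                    ≡⟨ cong (λ a → vector (g · a)) (element-+ v w) ⟩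
      vector (g · (element v ∙ element w))             ≡⟨ cong vector (fixing-homo g go≡o _ _) ⟩
      vector ((g · element v) ∙ (g · element w))       ≡⟨ vector-+ _ _ ⟩
      vector (g · element v) +ᵛ vector (g · element w) ≡⟨ cong₂ _+ᵛ_ (e v) (e w) ⟨
      (h ⟨$⟩ v) +ᵛ (h ⟨$⟩ w)                           ∎

    homogeneous : ∀ c v → h ⟨$⟩ (c ·ᵛ v) ≡ c ·ᵛ (h ⟨$⟩ v)
    homogeneous c v = begin
      h ⟨$⟩ (c ·ᵛ v)                            ≡⟨ e _ ⟩
      vector (g · element (c ·ᵛ v))             ≡⟨ cong (λ a → vector (g · a)) (element-· c v) ⟩
      vector (g · (Fin.toℕ c times element v))  ≡⟨ cong vector (Automorphism.to-times (automorphism g go≡o) (Fin.toℕ c) _) ⟩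
      vector (Fin.toℕ c times (g · element v))  ≡⟨ vector-times c _ ⟩
      c ·ᵛ vector (g · element v)               ≡⟨ cong (c ·ᵛ_) (e v) ⟨
      c ·ᵛ (h ⟨$⟩ v)                            ∎

  -- Composing g with the inverse of the translation by g · o gives an element that fixes `o`.
  Ĝ-product : ∀ h → h ∈ Member Ĝ ⇔
              (∃[ v ] ∃[ k ] (k ∈ Member Ĝ₀ × (∀ x → h ⟨$⟩ x ≡ v +ᵛ (k ⟨$⟩ x))))
  Ĝ-product h = mk⇔ split unsplit
    where
    open ≡-Reasoning
    split : h ∈ Member Ĝ → ∃[ v ] ∃[ k ] (k ∈ Member Ĝ₀ × (∀ x → h ⟨$⟩ x ≡ v +ᵛ (k ⟨$⟩ x)))
    split (g , _ , e) = vector b , induced g₀ , induced-Ĝ₀ fixes , λ x → begin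
      h ⟨$⟩ x                                          ≡⟨ e x ⟩
      vector (g · element x)                           ≡⟨ cong vector (·-invʳ (τ b) _) ⟨
      vector (b ∙ (inv (τ b) · g · element x))         ≡⟨ cong (λ a → vector (b ∙ a)) (·-∘ (inv (τ b)) g _) ⟨
      vector (b ∙ (g₀ · element x))                    ≡⟨ vector-+ _ _ ⟩
      vector b +ᵛ vector (g₀ · element x)              ∎
      where
      b  = g · o
      g₀ = inv (τ b) ∘ᴳ g
      fixes : g₀ · o ≡ o
      fixes = trans (·-∘ (inv (τ b)) g o) (trans (cong (inv (τ b) ·_) (sym (τ-o b))) (·-invˡ (τ b) o))

    unsplit : (∃[ v ] ∃[ k ] (k ∈ Member Ĝ₀ × (∀ x → h ⟨$⟩ x ≡ v +ᵛ (k ⟨$⟩ x)))) → h ∈ Member Ĝ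
    unsplit (v , k , (g , go≡o , e) , h≡v+k) = τ (element v) ∘ᴳ g , tt , λ x → begin
      h ⟨$⟩ x                                    ≡⟨ h≡v+k x ⟩
      v +ᵛ (k ⟨$⟩ x)                             ≡⟨ cong₂ _+ᵛ_ (sym (vector-element v)) (e x) ⟩
      vector (element v) +ᵛ vector (g · element x) ≡⟨ vector-+ _ _ ⟨
      vector (element v ∙ (g · element x))       ≡⟨ cong vector (·-∘ (τ (element v)) g _) ⟨
      vector ((τ (element v) ∘ᴳ g) · element x)  ∎

  M : Fin r → Subspace
  M i = record
    { Vector   = λ v → P i (element v)
    ; 0-closed = subst (P i) (sym element-0) (o∈α i)
    ; +-closed = λ {v} {w} Pv Pw → subst (P i) (sym (element-+ v w)) (∙-closed (P-isSubgroup i) Pv Pw)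
    ; ·-closed = λ c {v} Pv → subst (P i) (sym (element-· c v)) (P-times (Fin.toℕ c) Pv)
    }
    where
    P-times : ∀ k {a} → P i a → P i (k times a)
    P-times zero    Pa = o∈α i
    P-times (suc k) Pa = ∙-closed (P-isSubgroup i) Pa (P-times k Pa)

  vector∈M : ∀ {i a} → P i a → vector a ∈ Vector (M i)
  vector∈M {i} = subst (P i) (sym (element-vector _))

  coset⇒ : ∀ {i v x} → x ∈ Coset v (M i) → I (element x) (τ (element v) ∗ α i)
  coset⇒ {i} {v} (s , Ps , refl) = ∈-translate⇐
    (subst (P i) (sym (trans (cong ((element v ⁻¹) ∙_) (element-+ v s)) (\\-leftDividesʳ _ _))) Ps)

  coset⇐ : ∀ {i v x} → I (element x) (τ (element v) ∗ α i) → x ∈ Coset v (M i)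
  coset⇐ {i} {v} {x} x∈ = vector ((element v ⁻¹) ∙ element x) , vector∈M (∈-translate⇒ x∈) , (begin
    x                                                       ≡⟨ vector-element x ⟨
    vector (element x)                                      ≡⟨ cong vector (\\-leftDividesˡ (element v) _) ⟨
    vector (element v ∙ ((element v ⁻¹) ∙ element x))       ≡⟨ vector-+ _ _ ⟩
    vector (element v) +ᵛ vector ((element v ⁻¹) ∙ element x) ≡⟨ cong (_+ᵛ vector ((element v ⁻¹) ∙ element x)) (vector-element v) ⟩
    v +ᵛ vector ((element v ⁻¹) ∙ element x)                ∎)
    where open ≡-Reasoning

  -- For i ≠ j an inclusion would give N = P i · P j = P j, against properness.
  P-⊆⇒≡ : ∀ {i j} → (∀ {a} → P i a → P j a) → i ≡ j
  P-⊆⇒≡ {i} {j} Pi⊆Pj = decidable-stable (i Fin.≟ j) λ i≢j →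
    let x , x∉P   = proper j
        a , Pa , Q = factor i≢j x
    in x∉P (subst (P j) (\\-leftDividesˡ a x) (∙-closed (P-isSubgroup j) (Pi⊆Pj Pa) Q))

  M-distinct : ∀ i j → Vector (M i) ≐ Vector (M j) → i ≡ j
  M-distinct i j (Mi⊆Mj , _) = P-⊆⇒≡ λ {a} Pa → subst (P j) (element-vector a) (Mi⊆Mj (vector∈M Pa))

  sends : ∀ {g h i j} → g Induces h → g ∗ α i ≡ α j → Sends h (Vector (M i)) (Vector (M j))
  sends {g} {h} {i} {j} e gα≡α v = mk⇔
    (λ Pv → subst (P j) (sym image) (proj₁ (maps-α g gα≡α) Pv))
    (λ Phv → proj₂ (maps-α g gα≡α) (subst (P j) image Phv))
    where
    image : element (h ⟨$⟩ v) ≡ g · element v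
    image = trans (cong element (e v)) (element-vector _)

  M-invariant : ∀ h i → h ∈ Member Ĝ₀ → ∃[ j ] Sends h (Vector (M i)) (Vector (M j))
  M-invariant h i (g , go≡o , e) = let j , gα≡α = permutes-α g go≡o i in j , sends {g} {h} e gα≡α

  M-transitive : ∀ i j → ∃[ h ] (h ∈ Member Ĝ₀ × Sends h (Vector (M i)) (Vector (M j)))
  M-transitive i j = let g , go≡o , gα≡α = α-transitive i j in
    induced g , induced-Ĝ₀ go≡o , sends {g} {induced g} (λ _ → refl) gα≡α

  M-2-transitive : ∀ i j k l → i ≢ j → k ≢ l →
    ∃[ h ] (h ∈ Member Ĝ₀ × Sends h (Vector (M i)) (Vector (M k)) × Sends h (Vector (M j)) (Vector (M l)))
  M-2-transitive i j k l i≢j k≢l = let g , go≡o , gαi≡αk , gαj≡αl = α-2-transitive i≢j k≢l in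
    induced g , induced-Ĝ₀ go≡o ,
    sends {g} {induced g} (λ _ → refl) gαi≡αk , sends {g} {induced g} (λ _ → refl) gαj≡αl

  M-sum : ∀ {i j} → i ≢ j → ∀ v → v ∈ M i +ˢ M j
  M-sum i≢j v = let a , Pa , Q = factor i≢j (element v) in
    vector a , vector ((a ⁻¹) ∙ element v) , vector∈M Pa , vector∈M Q ,
    trans (sym (vector-element v)) (trans (cong vector (sym (\\-leftDividesˡ a _))) (vector-+ _ _))

  V/M-transitive : ∀ i v w → v ∉ Vector (M i) → w ∉ Vector (M i) →
    ∃[ h ] (h ∈ Member Ĝ₀ × Sends h (Vector (M i)) (Vector (M i)) × Sends h (Coset v (M i)) (Coset w (M i)))
  V/M-transitive i v w v∉M w∉M = let g , go≡o , gα≡α , e = coset-transitive v∉M w∉M in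
    induced g , induced-Ĝ₀ go≡o , sends {g} {induced g} (λ _ → refl) gα≡α , λ x → mk⇔
      (λ x∈ → coset⇐ (subst₂ I (sym (element-vector _)) e (I-map g (coset⇒ x∈))))
      (λ gx∈ → coset⇐ (I-unmap g (subst₂ I (element-vector _) (sym e) (coset⇒ gx∈))))

  element≢o : ∀ {v} → v ≢ 0ᵛ → element v ≢ o
  element≢o {v} v≢0 e = v≢0 (trans (sym (vector-element v))
    (trans (cong vector (trans e (sym element-0))) (vector-element 0ᵛ)))

  -- The `P i` factor of an element outside `P j` cannot be trivial.
  nontrivial : ∀ {i j} → i ≢ j → ∃[ a ] (P i a × a ≢ o)
  nontrivial {i} {j} i≢j =
    let x , x∉P   = proper j
        a , Pa , Q = factor i≢j x
    in a , Pa , λ a≡o → x∉P (subst (P j) (\\-leftDividesˡ a x)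
         (∙-closed (P-isSubgroup j) (subst (P j) (sym a≡o) (o∈α j)) Q))

  ⋃M*-orbit : ∀ {i j : Fin r} → i ≢ j → IsOrbit Ĝ₀ (λ v → ∃[ i ] (v ∈ Vector (M i) × v ≢ 0ᵛ))
  ⋃M*-orbit {i} i≢j = let a , Pa , a≢o = nontrivial i≢j in vector a , λ v → mk⇔
    (λ { (j , Pv , v≢0) → let g , go≡o , ga≡v = element-transitive Pa a≢o Pv (element≢o v≢0) in
         induced g , induced-Ĝ₀ go≡o ,
         trans (cong (λ b → vector (g · b)) (element-vector a)) (trans (cong vector ga≡v) (vector-element v)) })
    (λ { (h , (g , go≡o , e) , ha≡v) →
         let j , gα≡α = permutes-α g go≡o i
             ga≡v = trans (sym (element-vector _)) (cong element
                      (trans (cong (λ b → vector (g · b)) (sym (element-vector a))) (trans (sym (e _)) ha≡v)))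
         in j , subst (P j) ga≡v (proj₁ (maps-α g gα≡α) Pa) ,
            λ v≡0 → a≢o (trans (sym (·-invˡ g a))
              (trans (cong (inv g ·_) (trans ga≡v (trans (cong element v≡0) (trans element-0 (sym go≡o))))) (·-invˡ g o))) })

  -- The orbitals of 𝒢 on points; `noncollinear` may be empty, and the rank is then 2.
  data Kind (a b : Fin n) : Fin 3 → Set where
    equal        : a ≡ b → Kind a b 0F
    collinear    : a ≢ b → Collinear′ a b → Kind a b 1F
    noncollinear : a ≢ b → ¬ Collinear′ a b → Kind a b 2F

  collinear? : ∀ a b → Dec (Collinear′ a b)
  collinear? a b = ∃? (finite-Fin m) λ c → I? a c ×-dec I? b c

  kind : ∀ a b → ∃[ k ] Kind a b k
  kind a b with a Fin.≟ b | collinear? a b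
  ... | yes a≡b | _       = 0F , equal a≡b
  ... | no  a≢b | yes col = 1F , collinear a≢b col
  ... | no  a≢b | no ¬col = 2F , noncollinear a≢b ¬col

  kind-unique : ∀ {a b k l} → Kind a b k → Kind a b l → k ≡ l
  kind-unique (equal _)              (equal _)              = refl
  kind-unique (equal a≡b)            (collinear a≢b _)      = contradiction a≡b a≢b
  kind-unique (equal a≡b)            (noncollinear a≢b _)   = contradiction a≡b a≢b
  kind-unique (collinear a≢b _)      (equal a≡b)            = contradiction a≡b a≢b
  kind-unique (collinear _ _)        (collinear _ _)        = refl
  kind-unique (collinear _ col)      (noncollinear _ ¬col)  = contradiction col ¬col
  kind-unique (noncollinear a≢b _)   (equal a≡b)            = contradiction a≡b a≢b
  kind-unique (noncollinear _ ¬col)  (collinear _ col)      = contradiction col ¬col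
  kind-unique (noncollinear _ _)     (noncollinear _ _)     = refl

  ·-injective : ∀ g {a b} → g · a ≡ g · b → a ≡ b
  ·-injective g {a} {b} e = trans (sym (·-invˡ g a)) (trans (cong (inv g ·_) e) (·-invˡ g b))

  kind-map : ∀ g {a b k} → Kind a b k → Kind (g · a) (g · b) k
  kind-map g (equal a≡b)                  = equal (cong (g ·_) a≡b)
  kind-map g (collinear a≢b (c , a∈ , b∈)) =
    collinear (a≢b ∘ ·-injective g) (g ∗ c , I-map g a∈ , I-map g b∈)
  kind-map g {a} {b} (noncollinear a≢b ¬col) = noncollinear (a≢b ∘ ·-injective g) λ { (c , a∈ , b∈) →
    ¬col (inv g ∗ c , subst (λ x → I x (inv g ∗ c)) (·-invˡ g a) (I-map (inv g) a∈)
                    , subst (λ x → I x (inv g ∗ c)) (·-invˡ g b) (I-map (inv g) b∈)) }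

  kind-transitive : ∀ {a b a′ b′ k} → Kind a b k → Kind a′ b′ k → ∃[ g ] (g · a ≡ a′ × g · b ≡ b′)
  kind-transitive {a} {a′ = a′} (equal refl) (equal refl) =
    let g , _ , ga≡a′ = N-transitive a a′ in g , ga≡a′ , ga≡a′
  kind-transitive (collinear a≢b c)    (collinear a′≢b′ c′)    = transitive-collinear a≢b c a′≢b′ c′
  kind-transitive (noncollinear a≢b c) (noncollinear a′≢b′ c′) = transitive-noncollinear a≢b c a′≢b′ c′

  kind-everywhere : ∀ {a b k} → Kind a b k → ∀ x → ∃[ y ] Kind x y k
  kind-everywhere {a} {b} {k} κ x = let g , _ , ga≡x = N-transitive a x in
    g · b , subst (λ y → Kind y (g · b) k) ga≡x (kind-map g κ)

  -- Orbits of the stabiliser of x correspond to the kinds of pairs starting at x. The map `ι`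
  -- selects the kinds that occur, so ranks 2 and 3 need only one proof.
  rank : ∀ k (ι : Fin k → Fin 3) → (∀ {i j} → ι i ≡ ι j → i ≡ j) →
         (∀ a b → ∃[ i ] Kind a b (ι i)) → (∀ i → ∃[ a ] ∃[ b ] Kind a b (ι i)) → HasRank Ĝ k
  rank k ι ι-injective kindᵏ occurs =
      ((λ _ _ _ _ → _) , λ x y _ _ → let g , _ , gx≡y = N-transitive (element x) (element y) in
        induced g , induced-Ĝ g , trans (cong vector gx≡y) (vector-element y))
    , λ x → record
      { to        = λ (y , _) → label x y
      ; cong      = λ { {y , _} {z , _} → label-cong x y z }
      ; bijective = (λ { {y , _} {z , _} → label-injective x y z })
                  , λ i → let _ , _ , κ = occurs i
                              b , κ′    = kind-everywhere κ (element x) in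
                      (vector b , _) , λ { {z , _} z∼b → trans (label-cong x z (vector b) z∼b)
                        (ι-injective (kind-unique (proj₂ (kindᵏ (element x) (element (vector b))))
                          (subst (λ c → Kind (element x) c (ι i)) (sym (element-vector b)) κ′))) }
      }
    where
    label : V → V → Fin k
    label x y = proj₁ (kindᵏ (element x) (element y))

    fixed : ∀ {g : 𝒢} {h : Perm VSetoid} {v w} → g Induces h → h ⟨$⟩ v ≡ w → g · element v ≡ element w
    fixed e hv≡w = trans (sym (element-vector _)) (cong element (trans (sym (e _)) hv≡w))

    label-cong : ∀ x y z → SameOrbit (Stabiliser Ĝ x) y z → label x y ≡ label x z
    label-cong x y z (h , ((g , _ , e) , hx≡x) , hy≡z) = ι-injective (kind-unique
      (subst₂ (λ a b → Kind a b _) (fixed {g} {h} e hx≡x) (fixed {g} {h} e hy≡z)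
        (kind-map g (proj₂ (kindᵏ (element x) (element y)))))
      (proj₂ (kindᵏ (element x) (element z))))

    label-injective : ∀ x y z → label x y ≡ label x z → SameOrbit (Stabiliser Ĝ x) y z
    label-injective x y z e =
      let κ = proj₂ (kindᵏ (element x) (element y))
          g , gx≡x , gy≡z = kind-transitive (subst (λ i → Kind (element x) (element y) (ι i)) e κ)
                                            (proj₂ (kindᵏ (element x) (element z)))
      in induced g , (induced-Ĝ g , trans (cong vector gx≡x) (vector-element x))
       , trans (cong vector gy≡z) (vector-element z)

  some-collinear : ∀ {i j : Fin r} → i ≢ j → ∃[ a ] ∃[ b ] Kind a b 1F
  some-collinear i≢j = let x , Px , x≢o = nontrivial i≢j in o , x , collinear (x≢o ∘ sym) (collinear-o Px)

  rank2or3 : ∀ {i j : Fin r} → i ≢ j → HasRank Ĝ 2 ⊎ HasRank Ĝ 3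
  rank2or3 i≢j with ∃? Points (λ a → ∃? Points (λ b → ¬? (a Fin.≟ b) ×-dec ¬? (collinear? a b)))
  ... | yes (a , b , a≢b , ¬col) = inj₂ (rank 3 id id kind λ
    { 0F → o , o , equal refl
    ; 1F → some-collinear i≢j
    ; 2F → a , b , noncollinear a≢b ¬col
    })
  ... | no ¬∃ = inj₁ (rank 2 inject₁ Fin.inject₁-injective kind₂ λ
    { 0F → o , o , equal refl
    ; 1F → some-collinear i≢j
    })
    where
    kind₂ : ∀ a b → ∃[ i ] Kind a b (inject₁ {2} i)
    kind₂ a b with kind a b
    ... | 0F , κ                      = 0F , κ
    ... | 1F , κ                      = 1F , κ
    ... | 2F , noncollinear a≢b ¬col  = contradiction (a , b , a≢b , ¬col) ¬∃

  construction : VectorSpaceConstruction p d r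
  construction = record
    { Ĝ₀ = Ĝ₀
    ; Ĝ₀-linear = Ĝ₀-linear
    ; Ĝ = Ĝ
    ; Ĝ-product = Ĝ-product
    ; rank2or3 = rank2or3 (first≢second 3≤r)
    ; 3≤r = 3≤r
    ; M = M
    ; M-distinct = M-distinct
    ; M-invariant = M-invariant
    ; M-transitive = M-transitive
    ; M-2-transitive = M-2-transitive
    ; V≡M₁+M₂ = M-sum (first≢second 3≤r)
    ; V/M₁-transitive = V/M-transitive (inject≤ 0F 3≤r)
    ; ⋃M*-orbit = ⋃M*-orbit (first≢second 3≤r)
    }

  -- Blocks as cosets of the subspaces

  open VectorSpaceConstruction construction using (design; blockSetoid)
  open Setoid blockSetoid using () renaming (_≈_ to _≈ᵇ_)

  -- Any point of the block can represent the coset; hence `block` is inverted only up to equality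
  -- of subsets.
  block-label : Fin m → Fin r × V
  block-label c = class c , vector (proj₁ (inhabited c))

  block : Fin r × V → Fin m
  block (i , v) = τ (element v) ∗ α i

  incident-block : ∀ x b → Design._I_ design x b ⇔ I (element x) (block b)
  incident-block x b = mk⇔ coset⇒ coset⇐

  block-block-label : ∀ c → block (block-label c) ≡ c
  block-block-label c = let a , a∈c = inhabited c in
    trans (cong (λ x → τ x ∗ α (class c)) (element-vector a)) (sym (block≡translate a∈c))

  class-block : ∀ b → class (block b) ≡ proj₁ b
  class-block (i , v) = trans (class-N (N-τ _)) (class-α i)

  ≡⇒≈ᵇ : ∀ b b′ → block b ≡ block b′ → b ≈ᵇ b′
  ≡⇒≈ᵇ b b′ e = (λ {x} x∈ → coset⇐ (subst (I (element x)) e (coset⇒ x∈)))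
              , (λ {x} x∈ → coset⇐ (subst (I (element x)) (sym e) (coset⇒ x∈)))

  -- Labels are compared as subsets of V, so the class has to be recovered: translating an inclusion
  -- of cosets to `o` gives `P i` ⊆ `P j`, hence i = j, and parallel blocks with a common point
  -- agree.
  block-cong : ∀ b b′ → b ≈ᵇ b′ → block b ≡ block b′
  block-cong b@(i , v) b′@(j , w) (b⊆b′ , _) =
    parallel (trans (class-block b) (trans i≡j (sym (class-block b′)))) (∈-translate i a) a∈b′
    where
    a = element v
    a∈b′ : I a (block b′)
    a∈b′ = coset⇒ (b⊆b′ (coset⇐ (∈-translate i a)))

    b′≡ : block b′ ≡ τ a ∗ α j
    b′≡ = trans (block≡translate a∈b′) (cong (λ k → τ a ∗ α k) (class-block b′))

    i≡j : i ≡ j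
    i≡j = P-⊆⇒≡ λ {x} Px → subst (P j) (\\-leftDividesʳ a x) (∈-translate⇒
      (subst₂ I (element-vector (a ∙ x)) b′≡ (coset⇒ (b⊆b′ (coset⇐
        (subst (λ y → I y (τ a ∗ α i)) (sym (element-vector (a ∙ x))) (I-map (τ a) Px)))))))

  block-label-block : ∀ b → block-label (block b) ≈ᵇ b
  block-label-block b = ≡⇒≈ᵇ (block-label (block b)) b (block-block-label (block b))

-- From graphs to finite geometries

-- Turns permutations of a setoid, whose images are known only up to its equality, into an action on
-- indices. `·-unique` then reduces every law to the corresponding one in the setoid.
module Action
  {X : Setoid 0ℓ 0ℓ} (G : PermGroup X) {k : ℕ} (ρ : Fin k → Setoid.Carrier X)
  (ρ-injective : ∀ {a b} → Setoid._≈_ X (ρ a) (ρ b) → a ≡ b)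
  (invariant : ∀ g a → g ∈ Member G → ∃[ b ] Setoid._≈_ X (g ⟨$⟩ ρ a) (ρ b))
  where
  open Setoid X using (_≈_)
  private
    module X = Setoid X
    module Sym = Group (Sym X)

  𝒢 : Set
  𝒢 = Σ[ g ∈ Perm X ] g ∈ Member G

  infixr 8 _·_
  _·_ : 𝒢 → Fin k → Fin k
  (g , g∈G) · a = proj₁ (invariant g a g∈G)

  ·-image : ∀ g a → proj₁ g ⟨$⟩ ρ a ≈ ρ (g · a)
  ·-image (g , g∈G) a = proj₂ (invariant g a g∈G)

  ·-unique : ∀ g {a b} → proj₁ g ⟨$⟩ ρ a ≈ ρ b → g · a ≡ b
  ·-unique g {a} e = ρ-injective (X.trans (X.sym (·-image g a)) e)

  1ᴳ : 𝒢
  1ᴳ = Sym.ε , Subgroup.ε-closed G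

  infixr 9 _∘ᴳ_
  _∘ᴳ_ : 𝒢 → 𝒢 → 𝒢
  (g , g∈G) ∘ᴳ (h , h∈G) = g Sym.∙ h , Subgroup.∙-closed G g∈G h∈G

  inv : 𝒢 → 𝒢
  inv (g , g∈G) = g Sym.⁻¹ , Subgroup.⁻¹-closed G g∈G

  ·-1 : ∀ a → 1ᴳ · a ≡ a
  ·-1 a = ·-unique 1ᴳ X.refl

  ·-∘ : ∀ g h a → (g ∘ᴳ h) · a ≡ g · h · a
  ·-∘ g h a = ·-unique (g ∘ᴳ h) (X.trans (Inverse.to-cong (proj₁ g) (·-image h a)) (·-image g _))

  ·-invˡ : ∀ g a → inv g · g · a ≡ a
  ·-invˡ g a = ·-unique (inv g) (X.trans (Inverse.from-cong (proj₁ g) (X.sym (·-image g a)))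
                                         (Inverse.strictlyInverseʳ (proj₁ g) _))

  ·-invʳ : ∀ g a → g · inv g · a ≡ a
  ·-invʳ g a = ·-unique g (X.trans (Inverse.to-cong (proj₁ g) (X.sym (·-image (inv g) a)))
                                   (Inverse.strictlyInverseˡ (proj₁ g) _))

-- On a shortest walk of length at least 4, the start and the vertex three steps later lie on
-- opposite sides; an edge between them would shorten the walk by 2.
nonincident-pair : (Γ : BipartiteGraph) → (let open BipartiteGraph Γ) →
                   ∀ {u v δ} → 4 ≤ δ → Distance graph u v δ → ∃[ x ] ∃[ y ] ¬ (x — y)
nonincident-pair Γ {inj₁ x} (s≤s (s≤s (s≤s (s≤s _)))) (cons {w = inj₂ _} _ (cons {w = inj₁ _} _ (cons {w = inj₂ y} _ w)) , shortest)
  = x , y , λ x—y → shortest _ (s≤s (s≤s (n≤1+n _))) (cons {w = inj₂ y} x—y w)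
nonincident-pair Γ {inj₂ y} (s≤s (s≤s (s≤s (s≤s _)))) (cons {w = inj₁ _} _ (cons {w = inj₂ _} _ (cons {w = inj₁ x} _ w)) , shortest)
  = x , y , λ x—y → shortest _ (s≤s (s≤s (n≤1+n _))) (cons {w = inj₁ x} x—y w)

-- A walk to a vertex of the other side cannot be empty, so it has a first edge.
neighbour : (Γ : BipartiteGraph) → (let open BipartiteGraph Γ) →
            IsConnected graph → ∀ (x : Setoid.Carrier B) y → ∃[ z ] z — y
neighbour Γ connected x y with connected (inj₂ y) (inj₁ x)
... | _ , nil ()
... | _ , cons {w = inj₁ z} z—y _ = z , z—y

module Reduction
  (Γ : BipartiteGraph) (finite : IsFiniteBipartite Γ)
  (connected : IsConnected (BipartiteGraph.graph Γ))
  (G N : PermGroup (BipartiteGraph.Vertices Γ)) (N⊲G : N ⊲ G)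
  (r : ℕ) (3≤r : 3 ≤ r)
  (distance-transitive : LocallyDistanceTransitive (BipartiteGraph.graph Γ) G 4)
  (pairwise-transitive : PairwiseTransitive (adjacencyDesign Γ) G)
  (nicely-affine : NicelyAffine (adjacencyDesign Γ) N)
  (classes : NumberOfParallelClasses (adjacencyDesign Γ) N r)
  (regular : RegularOn N OnLeft)
  where
  open BipartiteGraph Γ
  open IsFiniteBipartite finite
  private
    module Vertices = Setoid Vertices
    module B  = Setoid B
    module B′ = Setoid B′
    module B-finite  = Inverse (proj₂ B-finite)
    module B′-finite = Inverse (proj₂ B′-finite)
    module PT = PairwiseTransitive pairwise-transitive
    module NA = NicelyAffine nicely-affine
    module classes = Bijection classes
    n = proj₁ B-finite
    m = proj₁ B′-finite

  point : Fin n → B.Carrier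
  point = B-finite.from

  line : Fin m → B′.Carrier
  line = B′-finite.from

  point-injective : ∀ {a b} → point a B.≈ point b → a ≡ b
  point-injective {a} {b} e = trans (sym (B-finite.strictlyInverseˡ a))
    (trans (B-finite.to-cong e) (B-finite.strictlyInverseˡ b))

  line-injective : ∀ {c d} → line c B′.≈ line d → c ≡ d
  line-injective {c} {d} e = trans (sym (B′-finite.strictlyInverseˡ c))
    (trans (B′-finite.to-cong e) (B′-finite.strictlyInverseˡ d))

  point-index : ∀ x → x B.≈ point (B-finite.to x)
  point-index x = B.sym (B-finite.strictlyInverseʳ x)

  line-index : ∀ y → y B′.≈ line (B′-finite.to y)
  line-index y = B′.sym (B′-finite.strictlyInverseʳ y)

  left-image : ∀ u → u ∈ OnLeft → ∃[ a ] u Vertices.≈ inj₁ (point a)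
  left-image (inj₁ x) _ = B-finite.to x , inj₁ (point-index x)

  right-image : ∀ u → u ∈ OnRight → ∃[ c ] u Vertices.≈ inj₂ (line c)
  right-image (inj₂ y) _ = B′-finite.to y , inj₂ (line-index y)

  points-invariant : ∀ g a → g ∈ Member G → ∃[ b ] g ⟨$⟩ inj₁ (point a) Vertices.≈ inj₁ (point b)
  points-invariant g a g∈G =
    left-image _ (Equivalence.to (IsDesignIsomorphism.maps-points (PT.G≤Aut g g∈G) (inj₁ (point a))) _)

  lines-invariant : ∀ g c → g ∈ Member G → ∃[ d ] g ⟨$⟩ inj₂ (line c) Vertices.≈ inj₂ (line d)
  lines-invariant g c g∈G =
    right-image _ (Equivalence.to (IsDesignIsomorphism.maps-blocks (PT.G≤Aut g g∈G) (inj₂ (line c))) _)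

  module OnPoints = Action G (inj₁ ∘ point) (point-injective ∘ Pointwise.drop-inj₁) points-invariant
  module OnLines  = Action G (inj₂ ∘ line) (line-injective ∘ Pointwise.drop-inj₂) lines-invariant

  open OnPoints
  open OnLines using () renaming
    (_·_ to _∗_; ·-∘ to ∗-∘; ·-invˡ to ∗-invˡ; ·-unique to ∗-unique; ·-image to ∗-image)

  class : Fin m → Fin r
  class c = classes.to (inj₂ (line c) , _)

  class-N : ∀ {g c} → proj₁ g ∈ Member N → class (g ∗ c) ≡ class c
  class-N {g} {c} g∈N = sym (classes.cong (proj₁ g , g∈N , ∗-image g c))

  incident-cong : ∀ {u v u′ v′} → u Vertices.≈ u′ → v Vertices.≈ v′ →
                  Design.Incident (adjacencyDesign Γ) u v → Design.Incident (adjacencyDesign Γ) u′ v′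
  incident-cong (inj₁ x≈x′) (inj₂ y≈y′) x—y = —-resp x≈x′ y≈y′ x—y

  I-map : ∀ g {a c} → point a — line c → point (g · a) — line (g ∗ c)
  I-map g {a} {c} i = incident-cong (·-image g a) (∗-image g c)
    (Equivalence.to (IsDesignIsomorphism.preserves-incident (PT.G≤Aut (proj₁ g) (proj₂ g))
      (inj₁ (point a)) (inj₂ (line c))) i)

  N-transitive : ∀ a b → ∃[ g ] (proj₁ g ∈ Member N × g · a ≡ b)
  N-transitive a b =
    let h , h∈N , e = proj₂ (proj₁ regular) (inj₁ (point a)) (inj₁ (point b)) _ _
        g = h , proj₁ N⊲G h∈N
    in g , h∈N , ·-unique g e

  N-fixes : ∀ {g a} → proj₁ g ∈ Member N → g · a ≡ a → ∀ u → proj₁ g ⟨$⟩ u Vertices.≈ u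
  N-fixes {g} {a} g∈N ga≡a = proj₂ regular (proj₁ g) (inj₁ (point a)) g∈N _
    (Vertices.trans (·-image g a) (Vertices.reflexive (cong (inj₁ ∘ point) ga≡a)))

  parallel : ∀ {a c d} → class c ≡ class d → point a — line c → point a — line d → c ≡ d
  parallel {a} {c} {d} c∥d a∈c a∈d = decidable-stable (c Fin.≟ d) λ c≢d →
    NA.same-orbit (line c) (line d) (c≢d ∘ line-injective) (classes.injective c∥d) (point a) (a∈c , a∈d)

  nonincident : ∃[ a ] ∃[ c ] ¬ (point a — line c)
  nonincident =
    let _ , ((_ , _ , distance) , _) , 4≤δ = LocallyDistanceTransitive.diameter≥s distance-transitive
        x , y , x—̸y = nonincident-pair Γ 4≤δ distance
    in B-finite.to x , B′-finite.to y , λ i → x—̸y (—-resp (B.sym (point-index x)) (B′.sym (line-index y)) i)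

  inhabited : ∀ c → ∃[ a ] point a — line c
  inhabited c = let z , z—c = neighbour Γ connected (point (proj₁ nonincident)) (line c) in
    B-finite.to z , —-resp (point-index z) B′.refl z—c

  lines-distinct : ∀ {c d} → class c ≢ class d → ¬ line c B′.≈ line d
  lines-distinct c∦d e = c∦d (cong class (line-injective e))

  -- Moving d by N onto a point of c shows that μ ≠ 0.
  meet : ∀ {c d} → class c ≢ class d → ∃[ a ] (point a — line c × point a — line d)
  meet {c} {d} c∦d =
    let a , a∈c         = inhabited c
        b , b∈d         = inhabited d
        g , g∈N , gb≡a  = N-transitive b a
        c∦gd            = λ e → c∦d (trans e (class-N {g} g∈N))
        a∈gd            = subst (λ x → point x — line (g ∗ d)) gb≡a (I-map g b∈d)
        index           = Bijection.to (common c∦gd) (point a , a∈c , a∈gd)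
        (x , x∈c , x∈d) , _ = Bijection.surjective (common c∦d) index
    in B-finite.to x , —-resp (point-index x) B′.refl x∈c , —-resp (point-index x) B′.refl x∈d
    where
    common : ∀ {c d} → class c ≢ class d → HasSize B (λ x → x — line c × x — line d) NA.μ
    common {c} {d} c∦d = NA.different-orbits (line c) (line d) (lines-distinct c∦d) (c∦d ∘ classes.cong)

  geometry : AffineGeometry r
  geometry = record
    { n = n
    ; m = m
    ; I = λ a c → point a — line c
    ; I? = λ a c → point a —? line c
    ; 𝒢 = 𝒢
    ; _·_ = _·_
    ; _∗_ = _∗_
    ; _∘ᴳ_ = _∘ᴳ_
    ; 1ᴳ = 1ᴳ
    ; inv = inv
    ; ·-1 = ·-1
    ; ·-∘ = ·-∘
    ; ·-invˡ = ·-invˡ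
    ; ·-invʳ = ·-invʳ
    ; ∗-∘ = ∗-∘
    ; ∗-invˡ = ∗-invˡ
    ; I-map = I-map
    ; N = λ g → proj₁ g ∈ Member N
    ; N-∘ = Subgroup.∙-closed N
    ; N-inv = Subgroup.⁻¹-closed N
    ; N-normal = λ (g , g∈G) {h} h∈N → proj₂ N⊲G g (proj₁ h) g∈G h∈N
    ; N-transitive = N-transitive
    ; N-semiregular = λ {g} {a} g∈N ga≡a b → ·-unique g (N-fixes {g} {a} g∈N ga≡a _)
    ; class = class
    ; class-N = λ {g} → class-N {g}
    ; N-class = λ c∥d → let h , h∈N , e = classes.injective c∥d
                            g = h , proj₁ N⊲G h∈N in g , h∈N , ∗-unique g e
    ; class-surjective = class-surjective
    ; parallel = parallel
    ; meet = meet
    ; inhabited = inhabited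
    ; nonincident = nonincident
    ; transitive-I = λ i i′ → flag (PT.incident _ _ _ _ i i′)
    ; transitive-¬I = λ i i′ → flag (PT.nonIncident _ _ _ _ i i′)
    ; transitive-collinear = λ a≢b col a′≢b′ col′ →
        points (PT.collinear _ _ _ _ (a≢b ∘ point-injective , on-line col) (a′≢b′ ∘ point-injective , on-line col′))
    ; transitive-noncollinear = λ a≢b ¬col a′≢b′ ¬col′ →
        points (PT.nonCollinear _ _ _ _ (a≢b ∘ point-injective , off-line ¬col) (a′≢b′ ∘ point-injective , off-line ¬col′))
    ; transitive-intersecting = λ c≢d (a , i) c′≢d′ (a′ , i′) →
        lines (PT.intersecting _ _ _ _ (c≢d ∘ line-injective , point a , i) (c′≢d′ ∘ line-injective , point a′ , i′))
    }
    where
    class-surjective : ∀ i → ∃[ c ] class c ≡ i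
    class-surjective i with classes.surjective i
    -- Surjectivity speaks of all blocks in the orbit of y; the identity of N shows that the indexed
    -- copy of y is one of them.
    ... | (inj₂ y , _) , e = B′-finite.to y , e (Group.ε (Sym Vertices) , Subgroup.ε-closed N , inj₂ (B′.sym (line-index y)))

    flag : ∀ {a c a′ c′} → ∃[ h ] (h ∈ Member G × h ⟨$⟩ inj₁ (point a) Vertices.≈ inj₁ (point a′)
                                                × h ⟨$⟩ inj₂ (line c) Vertices.≈ inj₂ (line c′)) →
           ∃[ g ] (g · a ≡ a′ × g ∗ c ≡ c′)
    flag (h , h∈G , e , e′) = (h , h∈G) , ·-unique (h , h∈G) e , ∗-unique (h , h∈G) e′

    points : ∀ {a b a′ b′} → ∃[ h ] (h ∈ Member G × h ⟨$⟩ inj₁ (point a) Vertices.≈ inj₁ (point a′)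
                                                  × h ⟨$⟩ inj₁ (point b) Vertices.≈ inj₁ (point b′)) →
             ∃[ g ] (g · a ≡ a′ × g · b ≡ b′)
    points (h , h∈G , e , e′) = (h , h∈G) , ·-unique (h , h∈G) e , ·-unique (h , h∈G) e′

    lines : ∀ {c d c′ d′} → ∃[ h ] (h ∈ Member G × h ⟨$⟩ inj₂ (line c) Vertices.≈ inj₂ (line c′)
                                                 × h ⟨$⟩ inj₂ (line d) Vertices.≈ inj₂ (line d′)) →
            ∃[ g ] (g ∗ c ≡ c′ × g ∗ d ≡ d′)
    lines (h , h∈G , e , e′) = (h , h∈G) , ∗-unique (h , h∈G) e , ∗-unique (h , h∈G) e′

    on-line : ∀ {a b} → ∃[ c ] (point a — line c × point b — line c) → ∃[ y ] (point a — y × point b — y)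
    on-line (c , i) = line c , i

    off-line : ∀ {a b} → ¬ (∃[ c ] (point a — line c × point b — line c)) → ¬ (∃[ y ] (point a — y × point b — y))
    off-line ¬col (y , a∈ , b∈) = ¬col (B′-finite.to y , —-resp B.refl (line-index y) a∈ , —-resp B.refl (line-index y) b∈)

  o : Fin n
  o = proj₁ nonincident

  -- The structure of N

  open TranslationGroup geometry o using (_∙_; translation; group; ∙-isGroup; commutative; prime-exponent)
  open Algebra.Properties.Monoid.Mult (Group.monoid group) renaming (_×_ to _times_)

  lift : ∀ {h} → h ∈ Member N → 𝒢
  lift {h} h∈N = h , proj₁ N⊲G h∈N

  module SymN = Group (Sym Vertices)
  open RawMonoidDefinitions SymN.rawMonoid using () renaming (_×_ to _timesᴺ_)

  -- Regularity makes an element of N that fixes one point the identity on all vertices, blocks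
  -- included. Identities in N can therefore be checked at `o`.
  N-agree : ∀ {g h} → g ∈ Member N → h ∈ Member N → ∀ {a} →
            g ⟨$⟩ inj₁ (point o) Vertices.≈ inj₁ (point a) → h ⟨$⟩ inj₁ (point o) Vertices.≈ inj₁ (point a) → g SymN.≈ h
  N-agree {g} {h} g∈N h∈N go ho u = Vertices.trans (Vertices.sym (Inverse.strictlyInverseˡ h (g ⟨$⟩ u)))
    (Inverse.to-cong h (proj₂ regular (h SymN.⁻¹ SymN.∙ g) (inj₁ (point o))
      (Subgroup.∙-closed N (Subgroup.⁻¹-closed N h∈N) g∈N) _
      (Vertices.trans (Inverse.from-cong h (Vertices.trans go (Vertices.sym ho))) (Inverse.strictlyInverseʳ h _)) u))

  -- Evaluation at `o` is a homomorphism from N to the group on points, so commutativity and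
  -- exponent p can be pulled back to N.
  product-image : ∀ {g h a b} → g ∈ Member N → h ∈ Member N →
                  g ⟨$⟩ inj₁ (point o) Vertices.≈ inj₁ (point a) → h ⟨$⟩ inj₁ (point o) Vertices.≈ inj₁ (point b) →
                  (g SymN.∙ h) ⟨$⟩ inj₁ (point o) Vertices.≈ inj₁ (point (a ∙ b))
  product-image {g} {h} {a} {b} g∈N h∈N go ho = Vertices.trans (Inverse.to-cong g ho)
    (Vertices.trans (·-image (lift g∈N) b) (Vertices.reflexive (cong (inj₁ ∘ point) (trans
      (translation {lift g∈N} g∈N b) (cong (_∙ b) (·-unique (lift g∈N) go))))))

  times-closed : ∀ k {g} → g ∈ Member N → k timesᴺ g ∈ Member N
  times-closed zero    g∈N = Subgroup.ε-closed N
  times-closed (suc k) g∈N = Subgroup.∙-closed N g∈N (times-closed k g∈N)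

  times-image : ∀ k {g a} → g ∈ Member N → g ⟨$⟩ inj₁ (point o) Vertices.≈ inj₁ (point a) →
                (k timesᴺ g) ⟨$⟩ inj₁ (point o) Vertices.≈ inj₁ (point (k times a))
  times-image zero    g∈N go = Vertices.refl
  times-image (suc k) {g} g∈N go = product-image {g} {k timesᴺ g} g∈N (times-closed k g∈N) go (times-image k g∈N go)

  elementary-abelian : IsElementaryAbelian N
  elementary-abelian = abelian , proj₁ exponent , proj₁ (proj₂ exponent) , λ g g∈N →
      let p   = proj₁ exponent
          gᵖ  = times-image p g∈N (·-image (lift g∈N) o)
      in N-agree {p timesᴺ g} {SymN.ε} (times-closed p g∈N) (Subgroup.ε-closed N)
           (Vertices.trans gᵖ (Vertices.reflexive (cong (inj₁ ∘ point) (proj₂ (proj₂ exponent) _)))) Vertices.refl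
    where
    exponent = prime-exponent (first≢second 3≤r)
    abelian : ∀ g h → g ∈ Member N → h ∈ Member N → g SymN.∙ h SymN.≈ h SymN.∙ g
    abelian g h g∈N h∈N =
      let go = ·-image (lift g∈N) o
          ho = ·-image (lift h∈N) o
      in N-agree {g SymN.∙ h} {h SymN.∙ g} (Subgroup.∙-closed N g∈N h∈N) (Subgroup.∙-closed N h∈N g∈N)
           (product-image {g} {h} g∈N h∈N go ho)
           (Vertices.trans (product-image {h} {g} h∈N g∈N ho go)
             (Vertices.reflexive (cong (inj₁ ∘ point) (commutative (first≢second 3≤r) _ _))))

  -- The isomorphism onto the constructed graph and design

  module Representation
    {p d : ℕ} .{{_ : NonZero p}} (coordinates : TranslationGroup.CoordinateSystem geometry o p d) where
    open VectorSpace p d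
    open FiniteGroup.CoordinateSystem coordinates
    open Construction geometry o 3≤r coordinates
    open VectorSpaceConstruction construction using (design; blockSetoid)

    φ : Inverse Vertices (VSetoid ⊎ₛ blockSetoid)
    φ = record
      { to        = to
      ; from      = from
      ; to-cong   = to-cong
      ; from-cong = from-cong
      ; inverse   = (λ {v} {u} e → Setoid.trans (VSetoid ⊎ₛ blockSetoid) (to-cong e) (to-from v))
                  , (λ {u} {v} e → Vertices.trans (from-cong e) (from-to u))
      }
      where
      to : Vertex → V ⊎ (Fin r × V)
      to (inj₁ x) = inj₁ (vector (B-finite.to x))
      to (inj₂ y) = inj₂ (block-label (B′-finite.to y))

      from : V ⊎ (Fin r × V) → Vertex
      from (inj₁ v) = inj₁ (point (element v))
      from (inj₂ b) = inj₂ (line (block b))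

      to-cong : ∀ {u v} → u Vertices.≈ v → Setoid._≈_ (VSetoid ⊎ₛ blockSetoid) (to u) (to v)
      to-cong (inj₁ e) = inj₁ (cong vector (B-finite.to-cong e))
      to-cong (inj₂ e) = inj₂ (Setoid.reflexive blockSetoid (cong block-label (B′-finite.to-cong e)))

      from-cong : ∀ {u v} → Setoid._≈_ (VSetoid ⊎ₛ blockSetoid) u v → from u Vertices.≈ from v
      from-cong (inj₁ e) = inj₁ (B.reflexive (cong (point ∘ element) e))
      from-cong (inj₂ {b} {b′} e) = inj₂ (B′.reflexive (cong line (block-cong b b′ e)))

      to-from : ∀ v → Setoid._≈_ (VSetoid ⊎ₛ blockSetoid) (to (from v)) v
      to-from (inj₁ v) = inj₁ (trans (cong vector (B-finite.strictlyInverseˡ _)) (vector-element v))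
      to-from (inj₂ b) = inj₂ (Setoid.trans blockSetoid
        {block-label (B′-finite.to (line (block b)))} {block-label (block b)} {b}
        (Setoid.reflexive blockSetoid (cong block-label (B′-finite.strictlyInverseˡ _))) (block-label-block b))

      from-to : ∀ u → from (to u) Vertices.≈ u
      from-to (inj₁ x) = inj₁ (B.trans (B.reflexive (cong point (element-vector _))) (B.sym (point-index x)))
      from-to (inj₂ y) = inj₂ (B′.trans (B′.reflexive (cong line (block-block-label _))) (B′.sym (line-index y)))

    incidence : ∀ x y → x — y ⇔ Design._I_ design (vector (B-finite.to x)) (block-label (B′-finite.to y))
    incidence x y = mk⇔
      (λ x—y → Equivalence.from (incident-block _ (block-label c)) (subst₂ (λ a c → point a — line c)
        (sym (element-vector a)) (sym (block-block-label c)) (—-resp (point-index x) (line-index y) x—y)))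
      (λ i → —-resp (B.sym (point-index x)) (B′.sym (line-index y)) (subst₂ (λ a c → point a — line c)
        (element-vector a) (block-block-label c) (Equivalence.to (incident-block _ (block-label c)) i)))
      where
      a = B-finite.to x
      c = B′-finite.to y

    maps-points : ∀ u → u ∈ OnLeft ⇔ φ ⟨$⟩ u ∈ OnLeft
    maps-points (inj₁ _) = mk⇔ id id
    maps-points (inj₂ _) = mk⇔ id id

    maps-blocks : ∀ u → u ∈ OnRight ⇔ φ ⟨$⟩ u ∈ OnRight
    maps-blocks (inj₁ _) = mk⇔ id id
    maps-blocks (inj₂ _) = mk⇔ id id

    graph-isomorphism : Γ ≅ᵍ incidenceGraph design
    graph-isomorphism = record
      { φ = φ ; isGraphIsomorphism = adjacency ; maps-B = maps-points ; maps-B′ = maps-blocks }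
      where
      adjacency : IsGraphIsomorphism graph (BipartiteGraph.graph (incidenceGraph design)) φ
      adjacency (inj₁ x) (inj₂ y) = incidence x y
      adjacency (inj₂ y) (inj₁ x) = incidence x y
      adjacency (inj₁ _) (inj₁ _) = mk⇔ id id
      adjacency (inj₂ _) (inj₂ _) = mk⇔ id id

    design-isomorphism : adjacencyDesign Γ ≅ᵈ design
    design-isomorphism = φ , record
      { maps-points = maps-points ; maps-blocks = maps-blocks ; preserves-incident = preserves }
      where
      preserves : ∀ u v → Design.Incident (adjacencyDesign Γ) u v ⇔ Design.Incident design (φ ⟨$⟩ u) (φ ⟨$⟩ v)
      preserves (inj₁ x) (inj₂ y) = incidence x y
      preserves (inj₁ _) (inj₁ _) = mk⇔ id id
      preserves (inj₂ _) (inj₁ _) = mk⇔ id id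
      preserves (inj₂ _) (inj₂ _) = mk⇔ id id

  obtained-from : ∀ {p d} (p-prime : Prime p) →
                  TranslationGroup.CoordinateSystem geometry o p d {{prime⇒nonZero p-prime}} →
                  ObtainedFromVectorSpace Γ r
  obtained-from {p} {d} p-prime coordinates = p , d , p-prime , construction , graph-isomorphism , design-isomorphism
    where
    instance _ = prime⇒nonZero p-prime
    open Construction geometry o 3≤r coordinates using (construction)
    open Representation coordinates

  obtained : ObtainedFromVectorSpace Γ r
  obtained = let p , p-prime , exponent = prime-exponent (first≢second 3≤r) in
    obtained-from p-prime (TranslationGroup.Coordinates.coordinates geometry o (commutative (first≢second 3≤r)) p-prime exponent)

theorem1p8 : (Γ : BipartiteGraph) → IsFiniteBipartite Γ →
    IsConnected (BipartiteGraph.graph Γ) →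
    (G N : PermGroup (BipartiteGraph.Vertices Γ)) →
    ActsOnGraph (BipartiteGraph.graph Γ) G →
    ¬ IsTrivial N → N ⊲ G →
    (r : ℕ) → 3 ≤ r →
    Starlike Γ N r →
    LocallyDistanceTransitive (BipartiteGraph.graph Γ) G 4 →
    PairwiseTransitive (adjacencyDesign Γ) G →
    NicelyAffine (adjacencyDesign Γ) N →
    NumberOfParallelClasses (adjacencyDesign Γ) N r →
    RegularOn N OnLeft →
    IsElementaryAbelian N × ObtainedFromVectorSpace Γ r
theorem1p8 Γ finite connected G N _ _ N⊲G r 3≤r _ distance-transitive pairwise-transitive nicely-affine classes regular =
  elementary-abelian , obtained
  where
  open Reduction Γ finite connected G N N⊲G r 3≤r distance-transitive pairwise-transitive nicely-affine classes regular
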